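{- Fix integers $d\ge1$, $k\ge2$ and $1\le t\le k-1$. Let $E$ be a set of $l$ unordered pairs $\{i,j\}$ of distinct indices in $\{1,\dots,k\}$ (so $l\le\binom{k}{2}$) such that every index $i$ lies in at most $t$ pairs of $E$. For every $\varepsilon>0$ there is a constant $C=C(\varepsilon,d,k)>0$ such that the following holds. Let $q$ be a prime power, $B$ a non-degenerate bilinear form on $\mathbb{F}_q^d$, and $\mathcal{A}_1,\dots,\mathcal{A}_k\subseteq\mathbb{F}_q^d$ with $|\mathcal{A}_i|\ge C\,q^{\frac{d-1}{2}+t}$ for all $i$. Then for any choice of $\lambda_{ij}\in\mathbb{F}_q^*$, $\{i,j\}\in E$, the number $S$ of tuples $(\mathbf{a}_1,\dots,\mathbf{a}_k)\in\mathcal{A}_1\times\cdots\times\mathcal{A}_k$ satisfying the system \[ B(\mathbf{a}_i,\mathbf{a}_j)=\lambda_{ij}\quad\text{for all }\{i,j\}\in E \] satisfies $\big|S-q^{ -l}\prod_{i=1}^k|\mathcal{A}_i|\big|\le \varepsilon\, q^{ -l}\prod_{i=1}^k|\mathcal{A}_i|$. (In asymptotic notation: if $|\mathcal{A}_i|\gg q^{\frac{d-1}{2}+t}$ then the system has $(1+o(1))q^{ -l}\prod_i|\mathcal{A}_i|$ solutions.)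
   Context: $B:\mathbb{F}_q^d\times\mathbb{F}_q^d\to\mathbb{F}_q$ is bilinear and non-degenerate; for each pair $\{i,j\}\in E$ the equation is written with the index order $(i,j)$ fixed once and for all. $\mathbb{F}_q^*=\mathbb{F}_q\setminus\{0\}$. -}

module Defs where

open import Algebra.Core using (Op₁; Op₂)
open import Algebra.Structures using (IsCommutativeRing)
open import Data.Fin.Base using (Fin)
open import Data.Fin.Properties as Fin using (nonZeroIndex; inj⇒≟)
open import Data.Integer.Base using (+_)
open import Data.List.Base as List using (List; []; _∷_; allFin; cartesianProductWith; filter; length)
open import Data.List.Relation.Unary.All as All using (All)
open import Data.List.Relation.Unary.AllPairs using (AllPairs)
open import Data.Nat.Base as ℕ using (ℕ; zero; suc; _^_; NonZero)
open import Data.Nat.ListAction using (product)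
open import Data.Nat.Primality using (Prime)
open import Data.Nat.Properties using (m^n≢0)
open import Data.Product.Base using (_×_; _,_; ∃; ∃-syntax)
open import Data.Rational.Base as ℚ using (ℚ; _/_)
open import Data.Sum.Base using (_⊎_)
open import Data.Vec.Base as Vec using (Vec; []; _∷_; lookup; replicate; zipWith)
open import Function.Bundles using (_↔_; Inverse)
open import Function.Properties.Inverse using (↔⇒↣)
open import Level using (0ℓ)
open import Relation.Binary.Definitions using (DecidableEquality)
open import Relation.Binary.PropositionalEquality.Core using (_≡_; _≢_)
open import Relation.Nullary.Decidable using (_×-dec_; _⊎-dec_)
open import Relation.Nullary.Negation.Core using (¬_)
open import Relation.Unary using (Pred; Decidable; _∈_)

IsPrimePower : ℕ → Set
IsPrimePower q = ∃[ p ] ∃[ n ] Prime p × 1 ℕ.≤ n × q ≡ p ^ n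

fromℕ : ℕ → ℚ
fromℕ n = + n / 1

-- AtLeast x C q m  says  x ≥ C · q^(m/2)  for C ≥ 0; both sides are squared because
-- q^(m/2) need not be rational.
AtLeast : (x : ℕ) (C : ℚ) (q m : ℕ) → Set
AtLeast x C q m = (C ℚ.* C) ℚ.* fromℕ (q ^ m) ℚ.≤ fromℕ x ℚ.* fromℕ x

vectors : {A : Set} → List A → (n : ℕ) → List (Vec A n)
vectors xs zero    = [] ∷ []
vectors xs (suc n) = cartesianProductWith _∷_ xs (vectors xs n)

SamePair : {k : ℕ} → Fin k × Fin k → Fin k × Fin k → Set
SamePair (i , j) (i′ , j′) = (i ≡ i′ × j ≡ j′) ⊎ (i ≡ j′ × j ≡ i′)

-- Each unordered pair {i,j} is listed exactly once, as (i , j) or as (j , i); the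
-- order listed is the order in which the pair enters the bilinear form.
record PairSet (k : ℕ) : Set where
  field
    pairs    : List (Fin k × Fin k)
    distinct : All (λ (i , j) → i ≢ j) pairs
    noRepeat : AllPairs (λ e f → ¬ SamePair e f) pairs

  size : ℕ
  size = length pairs

  degree : Fin k → ℕ
  degree v = length (filter (λ (i , j) → (v Fin.≟ i) ⊎-dec (v Fin.≟ j)) pairs)

record FiniteField (q : ℕ) : Set₁ where
  infixl 6 _+_
  infixl 7 _*_
  field
    Carrier           : Set
    _+_ _*_           : Op₂ Carrier
    -_                : Op₁ Carrier
    0# 1#             : Carrier
    isCommutativeRing : IsCommutativeRing _≡_ _+_ _*_ -_ 0# 1#
    0≢1               : 0# ≢ 1#
    inverse           : ∀ x → x ≢ 0# → ∃ λ y → x * y ≡ 1#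
    finite            : Carrier ↔ Fin q

  infix 4 _≟_
  _≟_ : DecidableEquality Carrier
  _≟_ = inj⇒≟ (↔⇒↣ finite)

  elements : List Carrier
  elements = List.map (Inverse.from finite) (allFin q)

  q≢0 : NonZero q
  q≢0 = nonZeroIndex (Inverse.to finite 0#)

  q^- : ℕ → ℚ
  q^- l = _/_ (+ 1) (q ^ l) {{m^n≢0 q l {{q≢0}}}}

module _ {q : ℕ} (F : FiniteField q) where
  open FiniteField F

  record IsBilinear {d : ℕ} (B : Vec Carrier d → Vec Carrier d → Carrier) : Set where
    field
      +-left  : ∀ x y z → B (zipWith _+_ x y) z ≡ B x z + B y z
      +-right : ∀ x y z → B x (zipWith _+_ y z) ≡ B x y + B x z
      *-left  : ∀ c x y → B (Vec.map (c *_) x) y ≡ c * B x y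
      *-right : ∀ c x y → B x (Vec.map (c *_) y) ≡ c * B x y

  record IsNonDegenerate {d : ℕ} (B : Vec Carrier d → Vec Carrier d → Carrier) : Set where
    field
      left  : ∀ x → (∀ y → B x y ≡ 0#) → x ≡ replicate d 0#
      right : ∀ y → (∀ x → B x y ≡ 0#) → y ≡ replicate d 0#

  card : {d : ℕ} {A : Pred (Vec Carrier d) 0ℓ} → Decidable A → ℕ
  card {d} A? = length (filter A? (vectors elements d))

  ∏card : {d k : ℕ} {A : Fin k → Pred (Vec Carrier d) 0ℓ} → (∀ i → Decidable (A i)) → ℕ
  ∏card {k = k} A? = product (List.map (λ i → card (A? i)) (allFin k))

  module _ {d k : ℕ} (B : Vec Carrier d → Vec Carrier d → Carrier)
           (E : PairSet k) (lam : Fin k → Fin k → Carrier) where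
    open PairSet E

    System : Pred (Vec (Vec Carrier d) k) 0ℓ
    System a = All (λ (i , j) → B (lookup a i) (lookup a j) ≡ lam i j) pairs

    system? : Decidable System
    system? a = All.all? (λ (i , j) → B (lookup a i) (lookup a j) ≟ lam i j) pairs

    solutionCount : {A : Fin k → Pred (Vec Carrier d) 0ℓ} → (∀ i → Decidable (A i)) → ℕ
    solutionCount {A} A? = length (filter solution? (vectors (vectors elements d) k))
      where
      solution? : Decidable (λ a → (∀ i → lookup a i ∈ A i) × System a)
      solution? a = Fin.all? (λ i → A? i (lookup a i)) ×-dec system? a

{-# OPTIONS --safe #-}

-- Write S(L) for the number of solutions of the equations indexed by a list L of pairs, and
-- K(a,b) = q [B(a,b) = λ] - 1.  Counting points on hyperplanes shows that ∑_b K(a,b) K(a′,b) is at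
-- most 0 for a ≠ a′ and at most q^(d+1) for a = a′; hence ∑_b (∑_a f(a) K(a,b))² ≤ q^(d+1) ∑_a f(a)²
-- for all f ≥ 0.  For e = {i,j} the difference q S(e ∷ L) - S(L) is the sum of K(x_i,x_j) over the
-- solutions x of L.  With the other coordinates fixed, the conditions on x_i and on x_j are independent
-- of each other, so the Cauchy–Schwarz inequality gives
--   (q S(e ∷ L) - S(L))² |A_i| |A_j| ≤ q^(d+1) S(L ∖ i) S(L ∖ j),
-- where L ∖ v consists of the pairs of L that do not contain v.  Since i and j lie in at most t - 1
-- pairs of L, induction on the number of pairs bounds the right-hand side, and each pair contributes
-- a relative error of at most 2/C.
module Submission where

open import Defs
open import Algebra.Bundles using (CommutativeRing)
import Algebra.Properties.Group as GroupProperties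
import Algebra.Properties.Ring as RingProperties
open import Data.Fin.Base as Fin using (Fin)
import Data.Fin.Properties as Fin
open import Data.Integer.Base as ℤ using (ℤ; +_; 0ℤ; 1ℤ; _+_; _*_; _-_; -_; _≤_)
import Data.Integer.Properties as ℤ
open import Data.Integer.Tactic.RingSolver using (solve-∀)
open import Data.List.Base as List using (List; []; _∷_; _++_; allFin; cartesianProductWith; filter; length)
import Data.List.Properties as List
open import Data.List.Membership.Propositional using (lose) renaming (_∈_ to _∈ˡ_)
open import Data.List.Membership.Propositional.Properties using (∈-allFin; ∈-cartesianProductWith⁺; ∈-filter⁺; ∈-lookup; ∈-map⁺)
open import Data.List.Relation.Unary.All as All using (All; []; _∷_)
import Data.List.Relation.Unary.All.Properties as All
open import Data.List.Relation.Unary.AllPairs as AllPairs using (AllPairs; _∷_)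
import Data.List.Relation.Unary.AllPairs.Properties as AllPairs
import Data.List.Relation.Unary.Any as Any
open import Data.Nat.Base as ℕ using (ℕ; zero; suc; _∸_; z≤n; s≤s)
open import Data.Nat.ListAction using (product)
import Data.Nat.Properties as ℕ
import Data.Nat.Tactic.RingSolver as ℕ-Solver
open import Data.Product.Base using (_×_; _,_; ∃; ∃-syntax; proj₁; proj₂)
open import Data.Rational.Base as ℚ using (ℚ; mkℚ; 0ℚ; 1ℚ; ∣_∣; toℚᵘ; _/_)
import Data.Rational.Properties as ℚ
open import Data.Rational.Unnormalised.Base as ℚᵘ using (mkℚᵘ)
import Data.Rational.Unnormalised.Properties as ℚᵘ
open import Data.Sum.Base using (_⊎_; inj₁; inj₂)
open import Data.Vec.Base as Vec using (Vec; []; _∷_; lookup; replicate; zipWith; _[_]≔_)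
import Data.Vec.Properties as Vec
open import Function.Base using (_∘_; case_of_)
open import Function.Bundles using (Inverse)
open import Level using (0ℓ)
open import Relation.Binary.PropositionalEquality using (_≡_; _≢_; refl; sym; trans; cong; cong₂; subst; subst₂; module ≡-Reasoning)
open import Relation.Nullary.Decidable using (Dec; yes; no; _×-dec_; _⊎-dec_; _→-dec_; ¬?; decidable-stable; map′)
open import Relation.Nullary.Negation using (¬_; contradiction)
open import Relation.Unary using (Pred; Decidable)

-- Finite sums

0≤i² : ∀ i → 0ℤ ≤ i * i
0≤i² (+ n)        = subst (0ℤ ≤_) (ℤ.pos-* n n) (ℤ.+≤+ z≤n)
0≤i² (ℤ.-[1+ n ]) = ℤ.+≤+ z≤n

0≤i*j : ∀ {i j} → 0ℤ ≤ i → 0ℤ ≤ j → 0ℤ ≤ i * j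
0≤i*j {i} {j} 0≤i 0≤j =
  subst (_≤ i * j) (ℤ.*-zeroʳ i) (ℤ.*-monoˡ-≤-nonNeg i {{ℤ.nonNegative 0≤i}} 0≤j)

module _ {A : Set} where

  ∑ : List A → (A → ℤ) → ℤ
  ∑ []       f = 0ℤ
  ∑ (x ∷ xs) f = f x + ∑ xs f

  syntax ∑ xs (λ x → e) = ∑[ x ← xs ] e

  ∑-cong : ∀ xs {f g : A → ℤ} → (∀ x → f x ≡ g x) → ∑ xs f ≡ ∑ xs g
  ∑-cong []       f≗g = refl
  ∑-cong (x ∷ xs) f≗g = cong₂ _+_ (f≗g x) (∑-cong xs f≗g)

  ∑-mono : ∀ xs {f g : A → ℤ} → (∀ x → f x ≤ g x) → ∑ xs f ≤ ∑ xs g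
  ∑-mono []       f≤g = ℤ.≤-refl
  ∑-mono (x ∷ xs) f≤g = ℤ.+-mono-≤ (f≤g x) (∑-mono xs f≤g)

  ∑-0 : ∀ xs → ∑[ _ ← xs ] 0ℤ ≡ 0ℤ
  ∑-0 []       = refl
  ∑-0 (x ∷ xs) = trans (ℤ.+-identityˡ _) (∑-0 xs)

  ∑-nonNeg : ∀ xs {f : A → ℤ} → (∀ x → 0ℤ ≤ f x) → 0ℤ ≤ ∑ xs f
  ∑-nonNeg xs 0≤f = subst (_≤ ∑ xs _) (∑-0 xs) (∑-mono xs 0≤f)

  ∑-const : ∀ xs c → ∑[ _ ← xs ] c ≡ + length xs * c
  ∑-const []       c = sym (ℤ.*-zeroˡ c)
  ∑-const (x ∷ xs) c = trans (cong (_+_ c) (∑-const xs c)) (sym (ℤ.suc-* (+ length xs) c))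

  ∑-+ : ∀ xs (f g : A → ℤ) → ∑[ x ← xs ] (f x + g x) ≡ ∑ xs f + ∑ xs g
  ∑-+ []       f g = refl
  ∑-+ (x ∷ xs) f g = trans (cong (_+_ (f x + g x)) (∑-+ xs f g)) (interchange (f x) (g x) (∑ xs f) (∑ xs g))
    where
    interchange : ∀ a b c d → a + b + (c + d) ≡ a + c + (b + d)
    interchange = solve-∀

  ∑-*ˡ : ∀ xs c (f : A → ℤ) → ∑[ x ← xs ] (c * f x) ≡ c * ∑ xs f
  ∑-*ˡ []       c f = sym (ℤ.*-zeroʳ c)
  ∑-*ˡ (x ∷ xs) c f = trans (cong (_+_ (c * f x)) (∑-*ˡ xs c f)) (sym (ℤ.*-distribˡ-+ c (f x) (∑ xs f)))

  ∑-*ʳ : ∀ xs c (f : A → ℤ) → ∑[ x ← xs ] (f x * c) ≡ ∑ xs f * c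
  ∑-*ʳ xs c f = trans (∑-cong xs (λ x → ℤ.*-comm (f x) c)) (trans (∑-*ˡ xs c f) (ℤ.*-comm c (∑ xs f)))

  ∑-neg : ∀ xs (f : A → ℤ) → ∑[ x ← xs ] (- f x) ≡ - ∑ xs f
  ∑-neg []       f = refl
  ∑-neg (x ∷ xs) f = trans (cong (_+_ (- f x)) (∑-neg xs f)) (sym (ℤ.neg-distrib-+ (f x) (∑ xs f)))

  ∑-- : ∀ xs (f g : A → ℤ) → ∑[ x ← xs ] (f x - g x) ≡ ∑ xs f - ∑ xs g
  ∑-- xs f g = trans (∑-+ xs f (-_ ∘ g)) (cong (_+_ (∑ xs f)) (∑-neg xs g))

  ∑-++ : ∀ xs ys (f : A → ℤ) → ∑ (xs ++ ys) f ≡ ∑ xs f + ∑ ys f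
  ∑-++ []       ys f = sym (ℤ.+-identityˡ _)
  ∑-++ (x ∷ xs) ys f = trans (cong (_+_ (f x)) (∑-++ xs ys f)) (sym (ℤ.+-assoc (f x) (∑ xs f) (∑ ys f)))

∑-map : ∀ {A B : Set} (g : A → B) xs (f : B → ℤ) → ∑ (List.map g xs) f ≡ ∑ xs (f ∘ g)
∑-map g []       f = refl
∑-map g (x ∷ xs) f = cong (_+_ (f (g x))) (∑-map g xs f)

∑-swap : ∀ {A B : Set} xs ys (f : A → B → ℤ) →
         ∑[ x ← xs ] ∑[ y ← ys ] f x y ≡ ∑[ y ← ys ] ∑[ x ← xs ] f x y
∑-swap []       ys f = sym (∑-0 ys)
∑-swap (x ∷ xs) ys f = trans (cong (_+_ (∑ ys (f x))) (∑-swap xs ys f)) (sym (∑-+ ys (f x) _))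

∑-product : ∀ {A B C : Set} (g : A → B → C) xs ys (f : C → ℤ) →
            ∑ (cartesianProductWith g xs ys) f ≡ ∑[ x ← xs ] ∑[ y ← ys ] f (g x y)
∑-product g []       ys f = refl
∑-product g (x ∷ xs) ys f = trans (∑-++ (List.map (g x) ys) _ f)
  (cong₂ _+_ (∑-map (g x) ys f) (∑-product g xs ys f))

∑*∑ : ∀ {A B : Set} xs ys (f : A → ℤ) (g : B → ℤ) → ∑ xs f * ∑ ys g ≡ ∑[ x ← xs ] ∑[ y ← ys ] (f x * g y)
∑*∑ xs ys f g = trans (sym (∑-*ʳ xs (∑ ys g) f)) (∑-cong xs (λ x → sym (∑-*ˡ ys (f x) g)))

-- Lagrange's identity: the double sum of the squares (u x v y - u y v x)² is non-negative and
-- equals twice the difference of the two sides.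
cauchySchwarz : ∀ {A : Set} xs (u v : A → ℤ) →
  ∑[ x ← xs ] (u x * v x) * ∑[ x ← xs ] (u x * v x) ≤ ∑[ x ← xs ] (u x * u x) * ∑[ x ← xs ] (v x * v x)
cauchySchwarz xs u v = ℤ.*-cancelˡ-≤-pos _ _ (+ 2) (ℤ.0≤i-j⇒j≤i (subst (0ℤ ≤_) lagrange
  (∑-nonNeg xs (λ x → ∑-nonNeg xs (λ y → 0≤i² (u x * v y - u y * v x))))))
  where
  open ≡-Reasoning
  uv uu vv : ℤ
  uv = ∑[ x ← xs ] (u x * v x)
  uu = ∑[ x ← xs ] (u x * u x)
  vv = ∑[ x ← xs ] (v x * v x)
  expand : ∀ a b c d → (a * d - c * b) * (a * d - c * b) ≡
           (a * a) * (d * d) + (b * b) * (c * c) - + 2 * ((a * b) * (c * d))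
  expand = solve-∀
  collect : ∀ p q r → p * q + q * p - + 2 * (r * r) ≡ + 2 * (p * q) - + 2 * (r * r)
  collect = solve-∀
  lagrange : ∑[ x ← xs ] ∑[ y ← xs ] ((u x * v y - u y * v x) * (u x * v y - u y * v x)) ≡
             + 2 * (uu * vv) - + 2 * (uv * uv)
  lagrange = begin
    _ ≡⟨ ∑-cong xs (λ x → ∑-cong xs (λ y → expand (u x) (v x) (u y) (v y))) ⟩
    _ ≡⟨ ∑-cong xs (λ x → trans (∑-- xs _ _) (cong₂ _-_ (∑-+ xs _ _) (∑-*ˡ xs (+ 2) _))) ⟩
    _ ≡⟨ trans (∑-- xs _ _) (cong₂ _-_ (∑-+ xs _ _) (∑-*ˡ xs (+ 2) _)) ⟩
    _ ≡⟨ cong₂ _-_ (cong₂ _+_ (∑*∑ xs xs _ _) (∑*∑ xs xs _ _)) (cong (+ 2 *_) (∑*∑ xs xs _ _)) ⟨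
    uu * vv + vv * uu - + 2 * (uv * uv) ≡⟨ collect uu vv uv ⟩
    + 2 * (uu * vv) - + 2 * (uv * uv) ∎

-- Indicator functions

𝟙 : {P : Set} → Dec P → ℤ
𝟙 (yes _) = 1ℤ
𝟙 (no  _) = 0ℤ

module _ {P Q : Set} where

  𝟙-cong : (p? : Dec P) (q? : Dec Q) → (P → Q) → (Q → P) → 𝟙 p? ≡ 𝟙 q?
  𝟙-cong (yes p) (yes q) f g = refl
  𝟙-cong (yes p) (no ¬q) f g = contradiction (f p) ¬q
  𝟙-cong (no ¬p) (yes q) f g = contradiction (g q) ¬p
  𝟙-cong (no ¬p) (no ¬q) f g = refl

  𝟙-× : {R : Set} (r? : Dec R) (p? : Dec P) (q? : Dec Q) →
        (R → P × Q) → (P → Q → R) → 𝟙 r? ≡ 𝟙 p? * 𝟙 q?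
  𝟙-× (yes r) (yes p) (yes q) f g = refl
  𝟙-× (yes r) (yes p) (no ¬q) f g = contradiction (proj₂ (f r)) ¬q
  𝟙-× (yes r) (no ¬p) q?      f g = contradiction (proj₁ (f r)) ¬p
  𝟙-× (no ¬r) (yes p) (yes q) f g = contradiction (g p q) ¬r
  𝟙-× (no ¬r) (yes p) (no ¬q) f g = refl
  𝟙-× (no ¬r) (no ¬p) q?      f g = sym (ℤ.*-zeroˡ (𝟙 q?))

module _ {P : Set} where

  𝟙-true : (p? : Dec P) → P → 𝟙 p? ≡ 1ℤ
  𝟙-true (yes _) p = refl
  𝟙-true (no ¬p) p = contradiction p ¬p

  𝟙-false : (p? : Dec P) → ¬ P → 𝟙 p? ≡ 0ℤ
  𝟙-false (yes p) ¬p = contradiction p ¬p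
  𝟙-false (no _)  ¬p = refl

  𝟙-idem : (p? : Dec P) → 𝟙 p? * 𝟙 p? ≡ 𝟙 p?
  𝟙-idem (yes _) = refl
  𝟙-idem (no _)  = refl

  0≤𝟙 : (p? : Dec P) → 0ℤ ≤ 𝟙 p?
  0≤𝟙 (yes _) = ℤ.+≤+ z≤n
  0≤𝟙 (no _)  = ℤ.+≤+ z≤n

length-filter-∑ : ∀ {A : Set} {P : A → Set} (P? : Decidable P) xs →
                  + length (filter P? xs) ≡ ∑[ x ← xs ] 𝟙 (P? x)
length-filter-∑ P? []       = refl
length-filter-∑ P? (x ∷ xs) with P? x
... | yes _ = cong (_+_ 1ℤ) (length-filter-∑ P? xs)
... | no  _ = trans (length-filter-∑ P? xs) (sym (ℤ.+-identityˡ _))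

∑-allFin-point : ∀ {n} (i : Fin n) {P : Fin n → Set} (P? : Decidable P) →
                 P i → (∀ j → P j → j ≡ i) → ∑[ j ← allFin n ] 𝟙 (P? j) ≡ 1ℤ
∑-allFin-point {suc n} i {P} P? Pi uniq = trans
  (cong (λ js → 𝟙 (P? Fin.zero) + ∑ js (𝟙 ∘ P?)) (sym (List.map-tabulate (λ j → j) Fin.suc)))
  (trans (cong (_+_ (𝟙 (P? Fin.zero))) (∑-map Fin.suc (allFin n) (𝟙 ∘ P?))) (split i Pi uniq))
  where
  split : ∀ i → P i → (∀ j → P j → j ≡ i) → 𝟙 (P? Fin.zero) + ∑[ j ← allFin n ] 𝟙 (P? (Fin.suc j)) ≡ 1ℤ
  split Fin.zero    Pi uniq = cong₂ _+_ (𝟙-true (P? Fin.zero) Pi)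
    (trans (∑-cong (allFin n) (λ j → 𝟙-false (P? (Fin.suc j)) (λ p → case uniq _ p of λ ()))) (∑-0 (allFin n)))
  split (Fin.suc i) Pi uniq = cong₂ _+_ (𝟙-false (P? Fin.zero) (λ p → case uniq _ p of λ ()))
    (∑-allFin-point i (λ j → P? (Fin.suc j)) Pi (λ j p → case uniq _ p of λ { refl → refl }))

-- Sums over tuples

∑-vectors-suc : ∀ {A : Set} (V : List A) n (f : Vec A (suc n) → ℤ) →
                ∑ (vectors V (suc n)) f ≡ ∑[ a ← V ] ∑[ x ← vectors V n ] f (a ∷ x)
∑-vectors-suc V n = ∑-product _∷_ V (vectors V n)

-- Averaging over a coordinate replaces summation over the tuples with that coordinate removed.
∑-update : ∀ {A : Set} (V : List A) {n} (i : Fin n) (f : Vec A n → ℤ) →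
           ∑[ x ← vectors V n ] ∑[ a ← V ] f (x [ i ]≔ a) ≡ + length V * ∑ (vectors V n) f
∑-update V {suc n} Fin.zero f = begin
  _ ≡⟨ ∑-vectors-suc V n _ ⟩
  _ ≡⟨ ∑-const V _ ⟩
  _ ≡⟨ cong (+ length V *_) (∑-swap (vectors V n) V _) ⟩
  _ ≡⟨ cong (+ length V *_) (∑-vectors-suc V n f) ⟨
  _ ∎
  where open ≡-Reasoning
∑-update V {suc n} (Fin.suc i) f = begin
  _ ≡⟨ ∑-vectors-suc V n _ ⟩
  _ ≡⟨ ∑-cong V (λ a → ∑-update V i (λ x → f (a ∷ x))) ⟩
  _ ≡⟨ ∑-*ˡ V (+ length V) _ ⟩
  _ ≡⟨ cong (+ length V *_) (∑-vectors-suc V n f) ⟨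
  _ ∎
  where open ≡-Reasoning

length-vectors : ∀ {A : Set} (V : List A) n → length (vectors V n) ≡ length V ℕ.^ n
length-vectors V zero    = refl
length-vectors V (suc n) = trans (length-× V (vectors V n)) (cong (length V ℕ.*_) (length-vectors V n))
  where
  length-× : ∀ {A B C : Set} {g : A → B → C} xs ys →
             length (cartesianProductWith g xs ys) ≡ length xs ℕ.* length ys
  length-× []       ys = refl
  length-× {g = g} (x ∷ xs) ys = trans (List.length-++ (List.map (g x) ys))
    (cong₂ ℕ._+_ (List.length-map (g x) ys) (length-× xs ys))

-- The kernel of a single equation

module FieldSums {q : ℕ} (F : FiniteField q) where
  open FiniteField F renaming (_+_ to _⊕_; _*_ to _⊗_; -_ to ⊖_)

  fieldRing : CommutativeRing 0ℓ 0ℓ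
  fieldRing = record { isCommutativeRing = isCommutativeRing }

  open CommutativeRing fieldRing 
    using (ring; +-group; +-assoc; -‿inverseʳ; *-assoc; *-comm; *-identityˡ; *-identityʳ; distribˡ; distribʳ; zeroˡ)
    renaming (_-_ to _⊝_)
  open GroupProperties +-group 
    using (\\-leftDividesˡ; \\-leftDividesʳ; //-rightDividesˡ; //-rightDividesʳ; x∙y⁻¹≈ε⇒x≈y; ∙-cancelʳ)

  open RingProperties ring using (-1*x≈-x)

  -- Sums over F_q and F_q^d

  length-elements : length elements ≡ q
  length-elements = trans (List.length-map _ (allFin q)) (List.length-tabulate _)

  -- Phrased for a decidable property with exactly one solution, so that it counts the roots of any
  -- uniquely solvable equation.
  ∑-elements-point : ∀ z {P : Carrier → Set} (P? : Decidable P) →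
                     P z → (∀ x → P x → x ≡ z) → ∑[ x ← elements ] 𝟙 (P? x) ≡ 1ℤ
  ∑-elements-point z {P} P? Pz uniq = trans (∑-map from (allFin q) (𝟙 ∘ P?))
    (∑-allFin-point (to z) (P? ∘ from) (subst P (sym (strictlyInverseʳ z)) Pz)
      (λ j Pj → trans (sym (strictlyInverseˡ j)) (cong to (uniq (from j) Pj))))
    where open Inverse finite

  ∑-elements-δ : ∀ z (h : Carrier → ℤ) → ∑[ x ← elements ] (𝟙 (x ≟ z) * h x) ≡ h z
  ∑-elements-δ z h = begin
    _ ≡⟨ ∑-cong elements concentrate ⟩
    _ ≡⟨ ∑-*ʳ elements (h z) _ ⟩
    _ ≡⟨ cong (_* h z) (∑-elements-point z (_≟ z) refl (λ _ x≡z → x≡z)) ⟩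
    _ ≡⟨ ℤ.*-identityˡ (h z) ⟩
    h z ∎
    where
    open ≡-Reasoning
    concentrate : ∀ x → 𝟙 (x ≟ z) * h x ≡ 𝟙 (x ≟ z) * h z
    concentrate x with x ≟ z
    ... | yes refl = refl
    ... | no _     = refl

  -- Double counting of the pairs (x , y) with y = x ⊕ c.
  ∑-elements-translate : ∀ c (h : Carrier → ℤ) → ∑[ x ← elements ] h (x ⊕ c) ≡ ∑ elements h
  ∑-elements-translate c h = begin
    _ ≡⟨ ∑-cong elements (λ x → ∑-elements-δ (x ⊕ c) h) ⟨
    _ ≡⟨ ∑-swap elements elements _ ⟩
    _ ≡⟨ ∑-cong elements (λ y → trans (∑-*ʳ elements (h y) _) (cong (_* h y) (unique y))) ⟩
    _ ≡⟨ ∑-cong elements (λ y → ℤ.*-identityˡ (h y)) ⟩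
    ∑ elements h ∎
    where
    open ≡-Reasoning
    unique : ∀ y → ∑[ x ← elements ] 𝟙 (y ≟ x ⊕ c) ≡ 1ℤ
    unique y = ∑-elements-point (y ⊝ c) (λ x → y ≟ x ⊕ c) (sym (//-rightDividesˡ c y))
      (λ { x refl → sym (//-rightDividesʳ c x) })

  -- With nonzero slope the only root is t = (e′ - e) / c.
  ∑-elements-linear : ∀ e e′ {c} → c ≢ 0# → ∑[ t ← elements ] 𝟙 (e ⊕ t ⊗ c ≟ e′) ≡ 1ℤ
  ∑-elements-linear e e′ {c} c≢0 with inverse c c≢0
  ... | c⁻¹ , c*c⁻¹≡1 = ∑-elements-point ((⊖ e ⊕ e′) ⊗ c⁻¹) (λ t → e ⊕ t ⊗ c ≟ e′) solves unique
    where
    open ≡-Reasoning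
    solves : e ⊕ (⊖ e ⊕ e′) ⊗ c⁻¹ ⊗ c ≡ e′
    solves = begin
      e ⊕ (⊖ e ⊕ e′) ⊗ c⁻¹ ⊗ c   ≡⟨ cong (e ⊕_) (*-assoc _ c⁻¹ c) ⟩
      e ⊕ (⊖ e ⊕ e′) ⊗ (c⁻¹ ⊗ c) ≡⟨ cong (λ z → e ⊕ (⊖ e ⊕ e′) ⊗ z) (trans (*-comm c⁻¹ c) c*c⁻¹≡1) ⟩
      e ⊕ (⊖ e ⊕ e′) ⊗ 1#        ≡⟨ cong (e ⊕_) (*-identityʳ _) ⟩
      e ⊕ (⊖ e ⊕ e′)             ≡⟨ \\-leftDividesˡ e e′ ⟩
      e′ ∎
    unique : ∀ t → e ⊕ t ⊗ c ≡ e′ → t ≡ (⊖ e ⊕ e′) ⊗ c⁻¹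
    unique t refl = begin
      t                              ≡⟨ *-identityʳ t ⟨
      t ⊗ 1#                         ≡⟨ cong (t ⊗_) c*c⁻¹≡1 ⟨
      t ⊗ (c ⊗ c⁻¹)                  ≡⟨ *-assoc t c c⁻¹ ⟨
      t ⊗ c ⊗ c⁻¹                    ≡⟨ cong (_⊗ c⁻¹) (\\-leftDividesʳ e (t ⊗ c)) ⟨
      (⊖ e ⊕ (e ⊕ t ⊗ c)) ⊗ c⁻¹ ∎

  -- Two lines of different slopes meet once: subtracting t c′ leaves an equation of slope c - c′.
  ∑-elements-crossing : ∀ e e′ {c c′} → c ≢ c′ → ∑[ t ← elements ] 𝟙 (e ⊕ t ⊗ c ≟ e′ ⊕ t ⊗ c′) ≡ 1ℤ
  ∑-elements-crossing e e′ {c} {c′} c≢c′ = trans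
    (∑-cong elements (λ t → 𝟙-cong (e ⊕ t ⊗ c ≟ e′ ⊕ t ⊗ c′) (e ⊕ t ⊗ (c ⊝ c′) ≟ e′) (subtract t) (add t)))
    (∑-elements-linear e e′ (c≢c′ ∘ x∙y⁻¹≈ε⇒x≈y c c′))
    where
    open ≡-Reasoning
    split : ∀ t → e ⊕ t ⊗ c ≡ e ⊕ t ⊗ (c ⊝ c′) ⊕ t ⊗ c′
    split t = begin
      e ⊕ t ⊗ c                       ≡⟨ cong (λ z → e ⊕ t ⊗ z) (//-rightDividesˡ c′ c) ⟨
      e ⊕ t ⊗ (c ⊝ c′ ⊕ c′)           ≡⟨ cong (e ⊕_) (distribˡ t (c ⊝ c′) c′) ⟩
      e ⊕ (t ⊗ (c ⊝ c′) ⊕ t ⊗ c′)     ≡⟨ +-assoc e _ _ ⟨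
      e ⊕ t ⊗ (c ⊝ c′) ⊕ t ⊗ c′ ∎
    add : ∀ t → e ⊕ t ⊗ (c ⊝ c′) ≡ e′ → e ⊕ t ⊗ c ≡ e′ ⊕ t ⊗ c′
    add t eq = trans (split t) (cong (_⊕ t ⊗ c′) eq)
    subtract : ∀ t → e ⊕ t ⊗ c ≡ e′ ⊕ t ⊗ c′ → e ⊕ t ⊗ (c ⊝ c′) ≡ e′
    subtract t eq = begin
      e ⊕ t ⊗ (c ⊝ c′)                        ≡⟨ //-rightDividesʳ (t ⊗ c′) _ ⟨
      e ⊕ t ⊗ (c ⊝ c′) ⊕ t ⊗ c′ ⊝ t ⊗ c′      ≡⟨ cong (_⊝ t ⊗ c′) (trans (sym (split t)) eq) ⟩
      e′ ⊕ t ⊗ c′ ⊝ t ⊗ c′                    ≡⟨ //-rightDividesʳ (t ⊗ c′) e′ ⟩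
      e′ ∎

  infix 4 _≟ᵛ_
  _≟ᵛ_ : ∀ {n} (x y : Vec Carrier n) → Dec (x ≡ y)
  _≟ᵛ_ = Vec.≡-dec _≟_

  ∈-vectors : ∀ {n} (x : Vec Carrier n) → x ∈ˡ vectors elements n
  ∈-vectors []      = Any.here refl
  ∈-vectors (c ∷ x) = ∈-cartesianProductWith⁺ _∷_
    (subst (_∈ˡ elements) (strictlyInverseʳ c) (∈-map⁺ from (∈-allFin (to c)))) (∈-vectors x)
    where open Inverse finite

  -- Running through the finitely many vectors decides an existential statement. This takes the
  -- place of excluded middle in the case distinctions below.
  search : ∀ {n} {P : Vec Carrier n → Set} → Decidable P → Dec (∃ P)
  search P? = map′ Any.satisfied (λ (x , Px) → lose (∈-vectors x) Px) (Any.any? P? (vectors elements _))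

  ∑-vectors-δ : ∀ {n} (z : Vec Carrier n) (h : Vec Carrier n → ℤ) →
                ∑[ x ← vectors elements n ] (𝟙 (x ≟ᵛ z) * h x) ≡ h z
  ∑-vectors-δ []      h = trans (ℤ.+-identityʳ _) (ℤ.*-identityˡ (h []))
  ∑-vectors-δ {suc n} (c ∷ z) h = begin
    _ ≡⟨ ∑-vectors-suc elements n _ ⟩
    _ ≡⟨ ∑-cong elements (λ a → ∑-cong (vectors elements n) (λ x → trans (cong (_* h (a ∷ x))
           (𝟙-× (a ∷ x ≟ᵛ c ∷ z) (a ≟ c) (x ≟ᵛ z) Vec.∷-injective (cong₂ _∷_))) (ℤ.*-assoc (𝟙 (a ≟ c)) _ _))) ⟩
    _ ≡⟨ ∑-cong elements (λ a → ∑-*ˡ (vectors elements n) (𝟙 (a ≟ c)) _) ⟩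
    _ ≡⟨ ∑-elements-δ c _ ⟩
    _ ≡⟨ ∑-vectors-δ z (h ∘ (c ∷_)) ⟩
    h (c ∷ z) ∎
    where open ≡-Reasoning

  _⊞_ : ∀ {n} → Vec Carrier n → Vec Carrier n → Vec Carrier n
  _⊞_ = zipWith _⊕_

  _⊡_ : ∀ {n} → Carrier → Vec Carrier n → Vec Carrier n
  c ⊡ x = Vec.map (c ⊗_) x

  ∑-vectors-translate : ∀ {n} (v : Vec Carrier n) (h : Vec Carrier n → ℤ) →
                        ∑[ x ← vectors elements n ] h (x ⊞ v) ≡ ∑ (vectors elements n) h
  ∑-vectors-translate []      h = refl
  ∑-vectors-translate {suc n} (c ∷ v) h = begin
    _ ≡⟨ ∑-vectors-suc elements n _ ⟩
    _ ≡⟨ ∑-cong elements (λ a → ∑-vectors-translate v (h ∘ ((a ⊕ c) ∷_))) ⟩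
    _ ≡⟨ ∑-elements-translate c (λ a → ∑ (vectors elements n) (h ∘ (a ∷_))) ⟩
    _ ≡⟨ ∑-vectors-suc elements n h ⟨
    _ ∎
    where open ≡-Reasoning

  -- For each fixed t the translation by t y permutes F_q^n. A sum over the space can thus be
  -- computed line by line in the direction y, each point being met q times.
  ∑-vectors-line : ∀ {n} (y : Vec Carrier n) (h : Vec Carrier n → ℤ) →
                   ∑[ x ← vectors elements n ] ∑[ t ← elements ] h (x ⊞ (t ⊡ y)) ≡ + q * ∑ (vectors elements n) h
  ∑-vectors-line {n} y h = begin
    _ ≡⟨ ∑-swap (vectors elements n) elements _ ⟩
    _ ≡⟨ ∑-cong elements (λ t → ∑-vectors-translate (t ⊡ y) h) ⟩
    _ ≡⟨ ∑-const elements _ ⟩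
    _ ≡⟨ cong (λ m → + m * ∑ (vectors elements n) h) length-elements ⟩
    _ ∎
    where open ≡-Reasoning

  length-space : ∀ n → length (vectors elements n) ≡ q ℕ.^ n
  length-space n = trans (length-vectors elements n) (cong (ℕ._^ n) length-elements)

  -- The Gram matrix of the kernel

  module Kernel {d : ℕ} (B : Vec Carrier d → Vec Carrier d → Carrier)
                (bilinear : IsBilinear F B) (nonDegenerate : IsNonDegenerate F B)
                (lam : Carrier) (lam≢0 : lam ≢ 0#) where
    open IsBilinear bilinear

    V : List (Vec Carrier d)
    V = vectors elements d

    N : ℤ
    N = + length V

    0≤N : 0ℤ ≤ N
    0≤N = ℤ.+≤+ z≤n

    hit : Vec Carrier d → Vec Carrier d → ℤ
    hit a b = 𝟙 (B a b ≟ lam)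

    -- The deviation of `hit` from its expected density 1/q, multiplied by q to stay in the
    -- integers.
    kernel : Vec Carrier d → Vec Carrier d → ℤ
    kernel a b = + q * hit a b - 1ℤ

    B-line : ∀ a b t y → B a (b ⊞ (t ⊡ y)) ≡ B a b ⊕ t ⊗ B a y
    B-line a b t y = trans (+-right a b (t ⊡ y)) (cong (B a b ⊕_) (*-right t a y))

    -- If all values agree, a - a′ pairs to zero with every vector, and non-degeneracy on the left
    -- makes it zero.
    separate : ∀ a a′ → a ≢ a′ → ∃ λ y → B a y ≢ B a′ y
    separate a a′ a≢a′ with search (λ y → ¬? (B a y ≟ B a′ y))
    ... | yes found = found
    ... | no  none  = contradiction (a≡a′ a a′ (IsNonDegenerate.left nonDegenerate _ vanish)) a≢a′
      where
      vanish : ∀ y → B (a ⊞ ((⊖ 1#) ⊡ a′)) y ≡ 0#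
      vanish y = begin
        B (a ⊞ ((⊖ 1#) ⊡ a′)) y   ≡⟨ +-left a _ y ⟩
        B a y ⊕ B ((⊖ 1#) ⊡ a′) y
          ≡⟨ cong₂ _⊕_ (decidable-stable (B a y ≟ B a′ y) (λ ne → none (y , ne))) (*-left (⊖ 1#) a′ y) ⟩
        B a′ y ⊕ (⊖ 1#) ⊗ B a′ y  ≡⟨ cancel (B a′ y) ⟩
        0# ∎
        where
        open ≡-Reasoning
        cancel : ∀ x → x ⊕ (⊖ 1#) ⊗ x ≡ 0#
        cancel x = trans (cong (_⊕ (⊖ 1#) ⊗ x) (sym (*-identityˡ x)))
          (trans (sym (distribʳ x 1# (⊖ 1#))) (trans (cong (_⊗ x) (-‿inverseʳ 1#)) (zeroˡ x)))
      a≡a′ : ∀ {n} (a a′ : Vec Carrier n) → a ⊞ ((⊖ 1#) ⊡ a′) ≡ replicate n 0# → a ≡ a′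
      a≡a′ []      []        _  = refl
      a≡a′ (x ∷ a) (x′ ∷ a′) eq = cong₂ _∷_
        (x∙y⁻¹≈ε⇒x≈y x x′ (trans (cong (x ⊕_) (sym (-1*x≈-x x′))) (Vec.∷-injectiveˡ eq)))
        (a≡a′ a a′ (Vec.∷-injectiveʳ eq))

    -- On each line in the direction y the map `B a` is affine with nonzero slope `B a y`, so it
    -- takes the value `lam` exactly once there.
    ∑-hit : ∀ a {y} → B a y ≢ 0# → + q * ∑ V (hit a) ≡ N
    ∑-hit a {y} Bay≢0 = begin
      _ ≡⟨ ∑-vectors-line y (hit a) ⟨
      _ ≡⟨ ∑-cong V (λ b → trans
             (∑-cong elements (λ t → cong (λ z → 𝟙 (z ≟ lam)) (B-line a b t y)))
             (∑-elements-linear (B a b) lam Bay≢0)) ⟩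
      _ ≡⟨ ∑-const V 1ℤ ⟩
      _ ≡⟨ ℤ.*-identityʳ N ⟩
      N ∎
      where open ≡-Reasoning

    ∑-kernel : ∀ a {y} → B a y ≢ 0# → ∑ V (kernel a) ≡ 0ℤ
    ∑-kernel a Bay≢0 = begin
      _       ≡⟨ ∑-- V _ _ ⟩
      _       ≡⟨ cong₂ _-_ (∑-*ˡ V (+ q) (hit a)) (trans (∑-const V 1ℤ) (ℤ.*-identityʳ N)) ⟩
      _       ≡⟨ cong (_- N) (∑-hit a Bay≢0) ⟩
      N - N   ≡⟨ ℤ.+-inverseʳ N ⟩
      0ℤ ∎
      where open ≡-Reasoning

    -- The only value of `B a` is 0, which differs from `lam`, so `hit a` vanishes.
    kernel-null : ∀ a → (∀ y → B a y ≡ 0#) → ∀ b → kernel a b ≡ - 1ℤ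
    kernel-null a null b = begin
      + q * hit a b - 1ℤ ≡⟨ cong (λ z → + q * z - 1ℤ) (𝟙-false (B a b ≟ lam) (λ eq → lam≢0 (trans (sym eq) (null b)))) ⟩
      + q * 0ℤ - 1ℤ      ≡⟨ cong (_- 1ℤ) (ℤ.*-zeroʳ (+ q)) ⟩
      - 1ℤ ∎
      where open ≡-Reasoning

    -- If b₀ is a common solution, the translates of the set of common solutions by s b₀ + t y
    -- with s, t ∈ F_q are pairwise disjoint.
    ∑-hit-hit : ∀ a a′ {y} → B a y ≢ B a′ y → + q * (+ q * ∑[ b ← V ] (hit a b * hit a′ b)) ≤ N
    ∑-hit-hit a a′ {y} Bay≢Ba′y with search (λ b → (B a b ≟ lam) ×-dec (B a′ b ≟ lam))
    ... | no none = subst (_≤ N) (sym vanish) 0≤N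
      where
      open ≡-Reasoning
      vanish : + q * (+ q * ∑[ b ← V ] (hit a b * hit a′ b)) ≡ 0ℤ
      vanish = begin
        _ ≡⟨ cong (λ z → + q * (+ q * z)) (trans (∑-cong V (λ b → trans
               (sym (𝟙-× ((B a b ≟ lam) ×-dec (B a′ b ≟ lam)) (B a b ≟ lam) (B a′ b ≟ lam) (λ r → r) _,_))
               (𝟙-false ((B a b ≟ lam) ×-dec (B a′ b ≟ lam)) (λ p → none (b , p))))) (∑-0 V)) ⟩
        + q * (+ q * 0ℤ) ≡⟨ cong (+ q *_) (ℤ.*-zeroʳ (+ q)) ⟩
        + q * 0ℤ         ≡⟨ ℤ.*-zeroʳ (+ q) ⟩
        0ℤ ∎
    ... | yes (b₀ , Bab₀ , Ba′b₀) = ℤ.≤-reflexive (begin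
        _ ≡⟨ cong (+ q *_) (∑-vectors-line b₀ both) ⟨
        _ ≡⟨ ∑-vectors-line y _ ⟨
        _ ≡⟨ ∑-cong V once ⟩
        _ ≡⟨ ∑-const V 1ℤ ⟩
        _ ≡⟨ ℤ.*-identityʳ N ⟩
        N ∎)
      where
      open ≡-Reasoning
      both : Vec Carrier d → ℤ
      both b = hit a b * hit a′ b
      B-plane : ∀ {a} → B a b₀ ≡ lam → ∀ b t s →
                B a ((b ⊞ (t ⊡ y)) ⊞ (s ⊡ b₀)) ≡ (B a b ⊕ t ⊗ B a y) ⊕ s ⊗ lam
      B-plane {a} eq b t s = trans (B-line a _ s b₀) (cong₂ (λ u v → u ⊕ s ⊗ v) (B-line a b t y) eq)
      module _ (b : Vec Carrier d) (t s : Carrier) where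
        u u′ : Carrier
        u  = B a b ⊕ t ⊗ B a y
        u′ = B a′ b ⊕ t ⊗ B a′ y
        decouple : both ((b ⊞ (t ⊡ y)) ⊞ (s ⊡ b₀)) ≡ 𝟙 (u ≟ u′) * 𝟙 (u ⊕ s ⊗ lam ≟ lam)
        decouple = begin
          _ ≡⟨ cong₂ (λ v w → 𝟙 (v ≟ lam) * 𝟙 (w ≟ lam)) (B-plane Bab₀ b t s) (B-plane Ba′b₀ b t s) ⟩
          _ ≡⟨ 𝟙-× ((u ⊕ s ⊗ lam ≟ lam) ×-dec (u′ ⊕ s ⊗ lam ≟ lam)) (u ⊕ s ⊗ lam ≟ lam) (u′ ⊕ s ⊗ lam ≟ lam) (λ r → r) _,_ ⟨
          -- Both equations carry the same shift s `lam`, so together they say that `u` and `u′`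
          -- agree and that the first equation holds.
          _ ≡⟨ 𝟙-× ((u ⊕ s ⊗ lam ≟ lam) ×-dec (u′ ⊕ s ⊗ lam ≟ lam)) (u ≟ u′) (u ⊕ s ⊗ lam ≟ lam)
                 (λ (p , p′) → ∙-cancelʳ (s ⊗ lam) u u′ (trans p (sym p′)) , p)
                 (λ u≡u′ p → p , subst (λ z → z ⊕ s ⊗ lam ≡ lam) u≡u′ p) ⟩
          _ ∎
      once : ∀ b → ∑[ t ← elements ] ∑[ s ← elements ] both ((b ⊞ (t ⊡ y)) ⊞ (s ⊡ b₀)) ≡ 1ℤ
      once b = begin
        _ ≡⟨ ∑-cong elements (λ t → ∑-cong elements (decouple b t)) ⟩
        -- For each t exactly one s solves the second condition, because `lam` is nonzero. The
        -- values `u` and `u′` are determined by b and t, so any element may stand in the place of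
        -- s; `t` is put there.
        _ ≡⟨ ∑-cong elements (λ t → trans (∑-*ˡ elements (𝟙 (u b t t ≟ u′ b t t)) _)
               (trans (cong (𝟙 (u b t t ≟ u′ b t t) *_) (∑-elements-linear (u b t t) lam lam≢0)) (ℤ.*-identityʳ _))) ⟩
        _ ≡⟨ ∑-elements-crossing (B a b) (B a′ b) Bay≢Ba′y ⟩
        1ℤ ∎

    -- The kernel of a null `a` is constantly -1. Being separated from `a`, the vector `a′` is not
    -- null, so its kernel sums to 0.
    ∑-kernel-null : ∀ a a′ → (∀ y → B a y ≡ 0#) → a ≢ a′ → ∑[ b ← V ] (kernel a b * kernel a′ b) ≡ 0ℤ
    ∑-kernel-null a a′ null a≢a′ with separate a a′ a≢a′
    ... | y , Bay≢Ba′y = begin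
      _ ≡⟨ ∑-cong V (λ b → cong (_* kernel a′ b) (kernel-null a null b)) ⟩
      _ ≡⟨ ∑-*ˡ V (- 1ℤ) _ ⟩
      _ ≡⟨ cong (- 1ℤ *_) (∑-kernel a′ (λ Ba′y≡0 → Bay≢Ba′y (trans (null y) (sym Ba′y≡0)))) ⟩
      0ℤ ∎
      where open ≡-Reasoning

    nonNull? : ∀ a → Dec (∃ λ y → B a y ≢ 0#)
    nonNull? a = search (λ y → ¬? (B a y ≟ 0#))

    ¬nonNull⇒null : ∀ {a} → ¬ (∃ λ y → B a y ≢ 0#) → ∀ y → B a y ≡ 0#
    ¬nonNull⇒null {a} none y = decidable-stable (B a y ≟ 0#) (λ ne → none (y , ne))

    -- When neither vector is null, the sum is q² times the number of common solutions minus N, and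
    -- `∑-hit-hit` bounds the first term by N.
    gram-off-diagonal : ∀ a a′ → a ≢ a′ → ∑[ b ← V ] (kernel a b * kernel a′ b) ≤ 0ℤ
    gram-off-diagonal a a′ a≢a′ with nonNull? a | nonNull? a′
    ... | no null | _ = ℤ.≤-reflexive (∑-kernel-null a a′ (¬nonNull⇒null null) a≢a′)
    ... | yes _ | no null = ℤ.≤-reflexive (trans (∑-cong V (λ b → ℤ.*-comm (kernel a b) (kernel a′ b)))
                                                 (∑-kernel-null a′ a (¬nonNull⇒null null) (a≢a′ ∘ sym)))
    ... | yes (_ , Bay≢0) | yes (_ , Ba′y≢0) = begin
      -- The expansion keeps the two kernels as whole terms, since their sums are known to vanish.
      _ ≡⟨ ∑-cong V (λ b → expand (+ q) (hit a b) (hit a′ b)) ⟩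
      _ ≡⟨ trans (∑-- V _ _) (cong₂ _-_ (trans (∑-*ˡ V (+ q) _) (cong (+ q *_) (∑-*ˡ V (+ q) _)))
             (trans (∑-+ V _ _) (cong₂ _+_ (trans (∑-+ V _ _) (cong₂ _+_ (∑-kernel a Bay≢0) (∑-kernel a′ Ba′y≢0)))
               (trans (∑-const V 1ℤ) (ℤ.*-identityʳ N))))) ⟩
      + q * (+ q * ∑[ b ← V ] (hit a b * hit a′ b)) - (0ℤ + 0ℤ + N)
        ≤⟨ ℤ.+-monoˡ-≤ (- (0ℤ + 0ℤ + N)) (∑-hit-hit a a′ (proj₂ (separate a a′ a≢a′))) ⟩
      N - (0ℤ + 0ℤ + N) ≡⟨ simplify N ⟩
      0ℤ ∎
      where
      open ℤ.≤-Reasoning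
      expand : ∀ q u v → (q * u - 1ℤ) * (q * v - 1ℤ) ≡ q * (q * (u * v)) - (q * u - 1ℤ + (q * v - 1ℤ) + 1ℤ)
      expand = solve-∀
      simplify : ∀ n → n - (0ℤ + 0ℤ + n) ≡ 0ℤ
      simplify = solve-∀

    1≤q : 1ℤ ≤ + q
    1≤q = ℤ.+≤+ (ℕ.>-nonZero⁻¹ q {{q≢0}})

    -- For a null `a` every term is 1. Otherwise `hit` is idempotent, so q² ∑ hit² equals q N, and
    -- the remaining terms contribute -N.
    gram-diagonal : ∀ a → ∑[ b ← V ] (kernel a b * kernel a b) ≤ + q * N
    gram-diagonal a with nonNull? a
    ... | no null = begin
      _      ≡⟨ ∑-cong V (λ b → cong (λ z → z * z) (kernel-null a (¬nonNull⇒null null) b)) ⟩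
      _      ≡⟨ ∑-const V 1ℤ ⟩
      N * 1ℤ ≡⟨ ℤ.*-comm N 1ℤ ⟩
      1ℤ * N ≤⟨ ℤ.*-monoʳ-≤-nonNeg N 1≤q ⟩
      + q * N ∎
      where open ℤ.≤-Reasoning
    ... | yes (_ , Bay≢0) = begin
      _ ≡⟨ ∑-cong V (λ b → trans (expand (+ q) (hit a b))
             (cong (λ z → + q * (+ q * z) - (kernel a b + kernel a b + 1ℤ)) (𝟙-idem (B a b ≟ lam)))) ⟩
      _ ≡⟨ trans (∑-- V _ _) (cong₂ _-_ (trans (∑-*ˡ V (+ q) _) (cong (+ q *_) (trans (∑-*ˡ V (+ q) _) (∑-hit a Bay≢0))))
             (trans (∑-+ V _ _) (cong₂ _+_ (trans (∑-+ V _ _) (cong₂ _+_ (∑-kernel a Bay≢0) (∑-kernel a Bay≢0)))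
               (trans (∑-const V 1ℤ) (ℤ.*-identityʳ N))))) ⟩
      + q * N - (0ℤ + 0ℤ + N) ≡⟨ simplify (+ q * N) N ⟩
      + q * N - N ≤⟨ ℤ.i≤j⇒i-k≤j N ℤ.≤-refl ⟩
      + q * N ∎
      where
      open ℤ.≤-Reasoning
      expand : ∀ q u → (q * u - 1ℤ) * (q * u - 1ℤ) ≡ q * (q * (u * u)) - (q * u - 1ℤ + (q * u - 1ℤ) + 1ℤ)
      expand = solve-∀
      simplify : ∀ m n → m - (0ℤ + 0ℤ + n) ≡ m - n
      simplify = solve-∀

    -- The indicator merges the two cases into one entrywise bound, which `∑-vectors-δ` can collapse
    -- to the diagonal.
    gram-bound : ∀ a a′ → ∑[ b ← V ] (kernel a b * kernel a′ b) ≤ 𝟙 (a′ ≟ᵛ a) * (+ q * N)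
    gram-bound a a′ with a′ ≟ᵛ a
    ... | yes refl = ℤ.≤-trans (gram-diagonal a) (ℤ.≤-reflexive (sym (ℤ.*-identityˡ (+ q * N))))
    ... | no a′≢a  = gram-off-diagonal a a′ (a′≢a ∘ sym)

    -- For f ≥ 0 the entrywise bound on the Gram matrix of the kernel is enough.
    kernel-norm : ∀ (f : Vec Carrier d → ℤ) → (∀ a → 0ℤ ≤ f a) →
      ∑[ b ← V ] (∑[ a ← V ] (f a * kernel a b) * ∑[ a ← V ] (f a * kernel a b)) ≤
      + q * N * ∑[ a ← V ] (f a * f a)
    kernel-norm f 0≤f = begin
      _ ≡⟨ ∑-cong V (λ b → ∑*∑ V V _ _) ⟩
      _ ≡⟨ ∑-swap V V _ ⟩
      _ ≡⟨ ∑-cong V (λ a → ∑-swap V V _) ⟩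
      _ ≡⟨ ∑-cong V (λ a → ∑-cong V (λ a′ → trans
             (∑-cong V (λ b → regroup (f a) (kernel a b) (f a′) (kernel a′ b))) (∑-*ˡ V (f a * f a′) _))) ⟩
      ∑[ a ← V ] ∑[ a′ ← V ] (f a * f a′ * ∑[ b ← V ] (kernel a b * kernel a′ b))
        ≤⟨ ∑-mono V (λ a → ∑-mono V (λ a′ → ℤ.*-monoˡ-≤-nonNeg (f a * f a′)
             {{ℤ.nonNegative (0≤i*j (0≤f a) (0≤f a′))}} (gram-bound a a′))) ⟩
      _ ≡⟨ ∑-cong V (λ a → trans (∑-cong V (λ a′ → rotate (f a) (f a′) (𝟙 (a′ ≟ᵛ a)) (+ q * N))) (∑-*ˡ V (+ q * N * f a) _)) ⟩
      _ ≡⟨ ∑-cong V (λ a → trans (cong (_*_ (+ q * N * f a)) (∑-vectors-δ a f)) (ℤ.*-assoc (+ q * N) (f a) (f a))) ⟩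
      _ ≡⟨ ∑-*ˡ V (+ q * N) _ ⟩
      _ ∎
      where
      open ℤ.≤-Reasoning
      regroup : ∀ a b c d → a * b * (c * d) ≡ a * c * (b * d)
      regroup = solve-∀
      rotate : ∀ x y u m → x * y * (u * m) ≡ m * x * (u * y)
      rotate = solve-∀

-- Systems of equations

Edge : ℕ → Set
Edge k = Fin k × Fin k

module _ {k : ℕ} (v : Fin k) where

  Incident : Edge k → Set
  Incident (i , j) = v ≡ i ⊎ v ≡ j

  incident? : Decidable Incident
  incident? (i , j) = (v Fin.≟ i) ⊎-dec (v Fin.≟ j)

  -- The count of `PairSet.degree`, for the arbitrary lists that the induction passes through.
  degree : List (Edge k) → ℕ
  degree L = length (filter incident? L)

  delete : List (Edge k) → List (Edge k)
  delete = filter (¬? ∘ incident?)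

module Systems {q : ℕ} (F : FiniteField q) {d k : ℕ}
               (B : Vec (FiniteField.Carrier F) d → Vec (FiniteField.Carrier F) d → FiniteField.Carrier F)
               (bilinear : IsBilinear F B) (nonDegenerate : IsNonDegenerate F B)
               (lam : Fin k → Fin k → FiniteField.Carrier F)
               (A : Fin k → Pred (Vec (FiniteField.Carrier F) d) 0ℓ) (A? : ∀ i → Decidable (A i)) where
  open FiniteField F using (Carrier; 0#; _≟_; elements; q≢0)
  open FieldSums F using (length-space; module Kernel)

  V : List (Vec Carrier d)
  V = vectors elements d

  X : List (Vec (Vec Carrier d) k)
  X = vectors V k

  N : ℤ
  N = + length V

  Holds : Vec (Vec Carrier d) k → Edge k → Set
  Holds x (i , j) = B (lookup x i) (lookup x j) ≡ lam i j

  holds? : ∀ x → Decidable (Holds x)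
  holds? x (i , j) = B (lookup x i) (lookup x j) ≟ lam i j

  record Sol (L : List (Edge k)) (x : Vec (Vec Carrier d) k) : Set where
    constructor ⟨_∣_⟩
    field
      members   : ∀ i → A i (lookup x i)
      equations : All (Holds x) L

  sol? : ∀ L → Decidable (Sol L)
  sol? L x = map′ (λ (inA , holds) → ⟨ inA ∣ holds ⟩) (λ (⟨ inA ∣ holds ⟩) → inA , holds)
    (Fin.all? (λ i → A? i (lookup x i)) ×-dec All.all? (holds? x) L)

  -- The conditions of L ∖ v, with nothing asked of coordinate v. The tuple still has an entry
  -- there, so `count⁻` counts each choice of the other coordinates N times.
  record Sol⁻ (v : Fin k) (L : List (Edge k)) (x : Vec (Vec Carrier d) k) : Set where
    constructor ⟨_∣_⟩⁻
    field
      members   : ∀ i → i ≢ v → A i (lookup x i)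
      equations : All (Holds x) (delete v L)

  sol⁻? : ∀ v L → Decidable (Sol⁻ v L)
  sol⁻? v L x = map′ (λ (inA , holds) → ⟨ inA ∣ holds ⟩⁻) (λ (⟨ inA ∣ holds ⟩⁻) → inA , holds)
    (Fin.all? (λ i → ¬? (i Fin.≟ v) →-dec A? i (lookup x i)) ×-dec All.all? (holds? x) (delete v L))

  count : List (Edge k) → ℕ
  count L = length (filter (sol? L) X)

  count⁻ : Fin k → List (Edge k) → ℤ
  count⁻ v L = ∑[ x ← X ] 𝟙 (sol⁻? v L x)

  count-∑ : ∀ L → + count L ≡ ∑[ x ← X ] 𝟙 (sol? L x)
  count-∑ L = length-filter-∑ (sol? L) X

  -- Every pair left in `delete v L` avoids v, so its equation reads only coordinates at which x and
  -- y agree.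
  Sol⁻-cong : ∀ {v L x y} → (∀ i → i ≢ v → lookup x i ≡ lookup y i) → Sol⁻ v L x → Sol⁻ v L y
  Sol⁻-cong {v} {L} {x} {y} eq ⟨ inA ∣ holds ⟩⁻ =
    ⟨ (λ i i≢v → subst (A i) (eq i i≢v) (inA i i≢v))
    ∣ All.zipWith transfer (holds , All.all-filter (¬? ∘ incident? v) L) ⟩⁻
    where
    transfer : ∀ {e} → Holds x e × ¬ Incident v e → Holds y e
    transfer {i , j} (eqn , v∉e) = trans
      (sym (cong₂ B (eq i (λ { refl → v∉e (inj₁ refl) })) (eq j (λ { refl → v∉e (inj₂ refl) })))) eqn

  Sol⁻-update : ∀ {v L x a} → Sol⁻ v L x → Sol⁻ v L (x [ v ]≔ a)
  Sol⁻-update {v} {x = x} {a} = Sol⁻-cong (λ i i≢v → sym (Vec.lookup∘update′ i≢v x a))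

  Sol⁻-update⁻ : ∀ {v L x a} → Sol⁻ v L (x [ v ]≔ a) → Sol⁻ v L x
  Sol⁻-update⁻ {v} {x = x} {a} = Sol⁻-cong (λ i i≢v → Vec.lookup∘update′ i≢v x a)

  Sol⇒Sol⁻ : ∀ v {L x} → Sol L x → Sol⁻ v L x
  Sol⇒Sol⁻ v ⟨ inA ∣ holds ⟩ = ⟨ (λ i _ → inA i) ∣ All.filter⁺ (¬? ∘ incident? v) holds ⟩⁻

  -- An equation of L missing from both deletions would belong to a pair containing i and j, and
  -- `new` excludes this pair from L.
  Sol⁻⇒Sol : ∀ {i j L x} → i ≢ j → All (λ e → ¬ SamePair (i , j) e) L →
             Sol⁻ j L x → Sol⁻ i L x → Sol L x
  Sol⁻⇒Sol {i} {j} {L} {x} i≢j new ⟨ inA ∣ holds ⟩⁻ ⟨ inA′ ∣ holds′ ⟩⁻ = ⟨ member ∣ All.tabulate solved ⟩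
    where
    member : ∀ m → A m (lookup x m)
    member m with m Fin.≟ j
    ... | yes refl = inA′ j (i≢j ∘ sym)
    ... | no m≢j   = inA m m≢j
    same : ∀ {e} → Incident i e → Incident j e → SamePair (i , j) e
    same (inj₁ refl) (inj₁ refl) = contradiction refl i≢j
    same (inj₁ refl) (inj₂ refl) = inj₁ (refl , refl)
    same (inj₂ refl) (inj₁ refl) = inj₂ (refl , refl)
    same (inj₂ refl) (inj₂ refl) = contradiction refl i≢j
    solved : ∀ {e} → e ∈ˡ L → Holds x e
    solved {e} e∈L with incident? j e
    ... | no  j∉e = All.lookup holds (∈-filter⁺ (¬? ∘ incident? j) e∈L j∉e)
    ... | yes j∈e = All.lookup holds′ (∈-filter⁺ (¬? ∘ incident? i) e∈L
                      (λ i∈e → All.lookup new e∈L (same {e} i∈e j∈e)))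

  Sol-delete : ∀ {v L x a} → Sol (delete v L) (x [ v ]≔ a) → A v a × Sol⁻ v L x
  Sol-delete {v} {L} {x} {a} ⟨ inA ∣ holds ⟩ =
    subst (A v) (Vec.lookup∘update v x a) (inA v) , Sol⁻-update⁻ ⟨ (λ i _ → inA i) ∣ holds ⟩⁻

  Sol-delete⁻ : ∀ {v L x a} → A v a → Sol⁻ v L x → Sol (delete v L) (x [ v ]≔ a)
  Sol-delete⁻ {v} {L} {x} {a} a∈A sol⁻ = ⟨ member ∣ Sol⁻.equations updated ⟩
    where
    updated : Sol⁻ v L (x [ v ]≔ a)
    updated = Sol⁻-update sol⁻
    member : ∀ i → A i (lookup (x [ v ]≔ a) i)
    member i with i Fin.≟ v
    ... | yes refl = subst (A v) (sym (Vec.lookup∘update v x a)) a∈A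
    ... | no i≢v   = Sol⁻.members updated i i≢v

  -- Letting coordinate v run over the whole space separates membership in A_v from all other
  -- conditions; this averaging produces the factor N.
  count-delete : ∀ v L → N * + count (delete v L) ≡ + card F (A? v) * count⁻ v L
  count-delete v L = begin
    _ ≡⟨ cong (N *_) (count-∑ (delete v L)) ⟩
    _ ≡⟨ ∑-update V v _ ⟨
    _ ≡⟨ ∑-cong X (λ x → ∑-cong V (λ a → 𝟙-× (sol? (delete v L) (x [ v ]≔ a)) (A? v a) (sol⁻? v L x)
           Sol-delete Sol-delete⁻)) ⟩
    _ ≡⟨ ∑-cong X (λ x → ∑-*ʳ V (𝟙 (sol⁻? v L x)) (𝟙 ∘ A? v)) ⟩
    _ ≡⟨ ∑-*ˡ X (∑ V (𝟙 ∘ A? v)) (𝟙 ∘ sol⁻? v L) ⟩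
    _ ≡⟨ cong (_* count⁻ v L) (length-filter-∑ (A? v) V) ⟨
    _ ∎
    where open ≡-Reasoning

  0<N : 0ℤ ℤ.< N
  0<N = ℤ.+<+ (subst (0 ℕ.<_) (sym (length-space d)) (ℕ.m^n>0 q {{q≢0}} d))

  -- The effect of adding one pair to a system

  module _ {i j : Fin k} {L : List (Edge k)} (i≢j : i ≢ j) (lam≢0 : lam i j ≢ 0#)
           (new : All (λ e → ¬ SamePair (i , j) e) L) where
    open Kernel B bilinear nonDegenerate (lam i j) lam≢0 using (kernel; kernel-norm)

    discrepancy : ℤ
    discrepancy = + q * + count ((i , j) ∷ L) - + count L

    private
      -- `f x` collects the conditions that do not involve coordinate j, and `g x` those that do not
      -- involve i. Conditions involving neither occur in both, which is harmless for indicators.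
      f : Vec (Vec Carrier d) k → Vec Carrier d → ℤ
      f x a = 𝟙 (sol⁻? j L (x [ i ]≔ a))

      g : Vec (Vec Carrier d) k → Vec Carrier d → ℤ
      g x b = 𝟙 (sol⁻? i L (x [ j ]≔ b))

      h : Vec (Vec Carrier d) k → Vec Carrier d → ℤ
      h x b = ∑[ a ← V ] (f x a * kernel a b)

    discrepancy-∑ : discrepancy ≡ ∑[ x ← X ] (𝟙 (sol? L x) * kernel (lookup x i) (lookup x j))
    discrepancy-∑ = begin
      _ ≡⟨ cong₂ _-_ (trans (cong (+ q *_) (count-∑ ((i , j) ∷ L))) (sym (∑-*ˡ X (+ q) _))) (count-∑ L) ⟩
      _ ≡⟨ ∑-- X _ _ ⟨
      _ ≡⟨ ∑-cong X (λ x → trans (cong (λ z → + q * z - 𝟙 (sol? L x))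
             (𝟙-× (sol? ((i , j) ∷ L) x) (holds? x (i , j)) (sol? L x)
               (λ { ⟨ inA ∣ eqn ∷ eqns ⟩ → eqn , ⟨ inA ∣ eqns ⟩ }) (λ eqn (⟨ inA ∣ eqns ⟩) → ⟨ inA ∣ eqn ∷ eqns ⟩)))
             (factor (+ q) (𝟙 (holds? x (i , j))) (𝟙 (sol? L x)))) ⟩
      _ ∎
      where
      open ≡-Reasoning
      factor : ∀ q u s → q * (u * s) - s ≡ s * (q * u - 1ℤ)
      factor = solve-∀

    -- No pair of L contains both i and j, so each condition reads at most one of the new entries a
    -- and b.
    decouple : ∀ x a b → 𝟙 (sol? L (x [ i ]≔ a [ j ]≔ b)) ≡ f x a * g x b
    decouple x a b = 𝟙-× (sol? L (x [ i ]≔ a [ j ]≔ b)) (sol⁻? j L (x [ i ]≔ a)) (sol⁻? i L (x [ j ]≔ b))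
      (λ sol → Sol⁻-update⁻ (Sol⇒Sol⁻ j sol) ,
               Sol⁻-update⁻ (subst (Sol⁻ i L) swap (Sol⇒Sol⁻ i sol)))
      (λ solⱼ solᵢ → Sol⁻⇒Sol i≢j new (Sol⁻-update solⱼ)
                       (subst (Sol⁻ i L) (sym swap) (Sol⁻-update solᵢ)))
      where
      swap : x [ i ]≔ a [ j ]≔ b ≡ x [ j ]≔ b [ i ]≔ a
      swap = Vec.[]≔-commutes x i j i≢j

    kernel-update : ∀ x a b → kernel (lookup (x [ i ]≔ a [ j ]≔ b) i) (lookup (x [ i ]≔ a [ j ]≔ b) j) ≡ kernel a b
    kernel-update x a b = cong₂ kernel
      (trans (Vec.lookup∘update′ i≢j (x [ i ]≔ a) b) (Vec.lookup∘update i x a))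
      (Vec.lookup∘update j (x [ i ]≔ a) b)

    -- Letting the coordinates j and i run over the space costs one factor N each and makes a and b
    -- vary independently.
    discrepancy-average : N * (N * discrepancy) ≡ ∑[ x ← X ] ∑[ b ← V ] (g x b * h x b)
    discrepancy-average = begin
      _ ≡⟨ cong (λ z → N * (N * z)) discrepancy-∑ ⟩
      _ ≡⟨ cong (N *_) (∑-update V j _) ⟨
      _ ≡⟨ ∑-update V i _ ⟨
      _ ≡⟨ ∑-cong X (λ x → ∑-cong V (λ a → ∑-cong V (λ b → trans
             (cong₂ _*_ (decouple x a b) (kernel-update x a b)) (regroup (f x a) (g x b) (kernel a b))))) ⟩
      _ ≡⟨ ∑-cong X (λ x → trans (∑-swap V V _) (∑-cong V (λ b → ∑-*ˡ V (g x b) _))) ⟩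
      _ ∎
      where
      open ≡-Reasoning
      regroup : ∀ u v w → u * v * w ≡ v * (u * w)
      regroup = solve-∀

    ∑-g² : ∑[ x ← X ] ∑[ b ← V ] (g x b * g x b) ≡ N * count⁻ i L
    ∑-g² = trans (∑-cong X (λ x → ∑-cong V (λ b → 𝟙-idem (sol⁻? i L (x [ j ]≔ b))))) (∑-update V j _)

    ∑-f² : ∑[ x ← X ] ∑[ a ← V ] (f x a * f x a) ≡ N * count⁻ j L
    ∑-f² = trans (∑-cong X (λ x → ∑-cong V (λ a → 𝟙-idem (sol⁻? j L (x [ i ]≔ a))))) (∑-update V i _)

    -- For each x this is `kernel-norm`, applicable because `f x` is an indicator and hence
    -- non-negative.
    ∑-h² : ∑[ x ← X ] ∑[ b ← V ] (h x b * h x b) ≤ + q * N * (N * count⁻ j L)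
    ∑-h² = begin
      _ ≤⟨ ∑-mono X (λ x → kernel-norm (f x) (λ a → 0≤𝟙 (sol⁻? j L (x [ i ]≔ a)))) ⟩
      _ ≡⟨ ∑-*ˡ X (+ q * N) _ ⟩
      _ ≡⟨ cong (_*_ (+ q * N)) ∑-f² ⟩
      _ ∎
      where open ℤ.≤-Reasoning

    0≤count⁻ : ∀ v → 0ℤ ≤ N * count⁻ v L
    0≤count⁻ v = 0≤i*j {N} (ℤ.+≤+ z≤n) (∑-nonNeg X (λ x → 0≤𝟙 (sol⁻? v L x)))

    discrepancy-average² : N * (N * discrepancy) * (N * (N * discrepancy)) ≤
                           N * count⁻ i L * (+ q * N * (N * count⁻ j L))
    discrepancy-average² = begin
      _ ≡⟨ cong (λ z → z * z) (trans discrepancy-average (sym (∑-product _,_ X V _))) ⟩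
      -- The inequality is applied once over all pairs (x , b), so that only the total sums of g²
      -- and h² enter.
      _ ≤⟨ cauchySchwarz (cartesianProductWith _,_ X V) (λ (x , b) → g x b) (λ (x , b) → h x b) ⟩
      _ ≡⟨ cong₂ _*_ (trans (∑-product _,_ X V _) ∑-g²) (∑-product _,_ X V _) ⟩
      _ ≤⟨ ℤ.*-monoˡ-≤-nonNeg (N * count⁻ i L) {{ℤ.nonNegative (0≤count⁻ i)}} ∑-h² ⟩
      _ ∎
      where open ℤ.≤-Reasoning

    -- Multiplying by |A_i| |A_j| turns both `count⁻` factors into solution counts of smaller
    -- systems, to which induction can be applied. The factor N⁴ introduced by averaging then
    -- cancels.
    edge-discrepancy : discrepancy * discrepancy * (+ card F (A? i) * + card F (A? j)) ≤
                       + q * N * (+ count (delete i L) * + count (delete j L))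
    edge-discrepancy = ℤ.*-cancelˡ-≤-pos _ _ (N * N * (N * N)) {{N⁴>0}} (begin
      N * N * (N * N) * (discrepancy * discrepancy * (αᵢ * αⱼ))
        ≡⟨ pull N discrepancy (αᵢ * αⱼ) ⟩
      N * (N * discrepancy) * (N * (N * discrepancy)) * (αᵢ * αⱼ)
        ≤⟨ ℤ.*-monoʳ-≤-nonNeg (αᵢ * αⱼ) {{ℤ.nonNegative (0≤i*j {αᵢ} {αⱼ} (ℤ.+≤+ z≤n) (ℤ.+≤+ z≤n))}} discrepancy-average² ⟩
      N * count⁻ i L * (+ q * N * (N * count⁻ j L)) * (αᵢ * αⱼ)
        ≡⟨ gather N (+ q) (count⁻ i L) (count⁻ j L) αᵢ αⱼ ⟩
      N * N * (+ q * N) * (αᵢ * count⁻ i L * (αⱼ * count⁻ j L))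
        ≡⟨ cong₂ (λ u v → N * N * (+ q * N) * (u * v)) (count-delete i L) (count-delete j L) ⟨
      N * N * (+ q * N) * (N * + count (delete i L) * (N * + count (delete j L)))
        ≡⟨ spread N (+ q) (+ count (delete i L)) (+ count (delete j L)) ⟩
      N * N * (N * N) * (+ q * N * (+ count (delete i L) * + count (delete j L))) ∎)
      where
      open ℤ.≤-Reasoning
      αᵢ αⱼ : ℤ
      αᵢ = + card F (A? i)
      αⱼ = + card F (A? j)
      N²>0 : 0ℤ ℤ.< N * N
      N²>0 = subst (ℤ._< N * N) (ℤ.*-zeroʳ N) (ℤ.*-monoˡ-<-pos N {{ℤ.positive 0<N}} 0<N)
      N⁴>0 : ℤ.Positive (N * N * (N * N))
      N⁴>0 = ℤ.positive (subst (ℤ._< N * N * (N * N)) (ℤ.*-zeroʳ (N * N)) (ℤ.*-monoˡ-<-pos (N * N) {{ℤ.positive N²>0}} N²>0))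
      pull : ∀ n x c → n * n * (n * n) * (x * x * c) ≡ n * (n * x) * (n * (n * x)) * c
      pull = solve-∀
      gather : ∀ n q s t a b → n * s * (q * n * (n * t)) * (a * b) ≡ n * n * (q * n) * (a * s * (b * t))
      gather = solve-∀
      spread : ∀ n q s t → n * n * (q * n) * (n * s * (n * t)) ≡ n * n * (n * n) * (q * n * (s * t))
      spread = solve-∀

-- Auxiliary facts on lists, natural numbers and products of sets

module _ {A : Set} {P : A → Set} (P? : Decidable P) where

  length-filter-¬ : ∀ xs → length (filter (¬? ∘ P?) xs) ℕ.+ length (filter P? xs) ≡ length xs
  length-filter-¬ []       = refl
  length-filter-¬ (x ∷ xs) with P? x
  ... | yes _ = trans (ℕ.+-suc _ _) (cong suc (length-filter-¬ xs))
  ... | no  _ = cong suc (length-filter-¬ xs)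

  length-filter-∷ : ∀ x xs → length (filter P? xs) ℕ.≤ length (filter P? (x ∷ xs))
  length-filter-∷ x xs with P? x
  ... | yes _ = ℕ.n≤1+n _
  ... | no  _ = ℕ.≤-refl

  length-filter-filter : ∀ {Q : A → Set} (Q? : Decidable Q) xs →
                         length (filter P? (filter Q? xs)) ℕ.≤ length (filter P? xs)
  length-filter-filter Q? []       = ℕ.≤-refl
  length-filter-filter Q? (x ∷ xs) with Q? x
  ... | no  _ = ℕ.≤-trans (length-filter-filter Q? xs) (length-filter-∷ x xs)
  ... | yes _ with P? x
  ...   | yes _ = s≤s (length-filter-filter Q? xs)
  ...   | no  _ = length-filter-filter Q? xs

lookup-injective : ∀ {A : Set} {xs : List A} → AllPairs _≢_ xs →
                   ∀ {i j} → List.lookup xs i ≡ List.lookup xs j → i ≡ j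
lookup-injective (x∉xs ∷ xs!) {Fin.zero}  {Fin.zero}  eq = refl
lookup-injective (x∉xs ∷ xs!) {Fin.zero}  {Fin.suc j} eq = contradiction eq (All.lookup x∉xs (∈-lookup j))
lookup-injective (x∉xs ∷ xs!) {Fin.suc i} {Fin.zero}  eq = contradiction (sym eq) (All.lookup x∉xs (∈-lookup i))
lookup-injective (x∉xs ∷ xs!) {Fin.suc i} {Fin.suc j} eq = cong Fin.suc (lookup-injective xs! eq)

-- Distinct positions carry distinct ordered pairs, which embed into `Fin (k * k)`. Using k² instead
-- of the binomial coefficient affects only the constant C.
size≤k*k : ∀ {k} (E : PairSet k) → PairSet.size E ℕ.≤ k ℕ.* k
size≤k*k {k} E = Fin.injective⇒≤ {f = λ n → let (i , j) = List.lookup pairs n in Fin.combine i j}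
  (λ {m} {n} eq → lookup-injective unique (pair-≡ (Fin.combine-injective _ _ _ _ eq)))
  where
  open PairSet E
  unique : AllPairs _≢_ pairs
  unique = AllPairs.map (λ { ¬same refl → ¬same (inj₁ (refl , refl)) }) noRepeat
  pair-≡ : ∀ {p q : Edge k} → proj₁ p ≡ proj₁ q × proj₂ p ≡ proj₂ q → p ≡ q
  pair-≡ (refl , refl) = refl

∣+m-+n∣ : ∀ m n → ℤ.∣ + m - + n ∣ ≡ ℕ.∣ m - n ∣
∣+m-+n∣ m n = trans (cong ℤ.∣_∣ (ℤ.[+m]-[+n]≡m⊖n m n)) (∣m⊖n∣ m n)
  where
  ∣m⊖n∣ : ∀ m n → ℤ.∣ m ℤ.⊖ n ∣ ≡ ℕ.∣ m - n ∣
  ∣m⊖n∣ zero    zero    = refl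
  ∣m⊖n∣ zero    (suc n) = refl
  ∣m⊖n∣ (suc m) zero    = refl
  ∣m⊖n∣ (suc m) (suc n) = trans (cong ℤ.∣_∣ (ℤ.[1+m]⊖[1+n]≡m⊖n m n)) (∣m⊖n∣ m n)

∣i∣²≡i² : ∀ i → + (ℤ.∣ i ∣ ℕ.* ℤ.∣ i ∣) ≡ i * i
∣i∣²≡i² (+ n)        = ℤ.pos-* n n
∣i∣²≡i² (ℤ.-[1+ n ]) = refl

m²≤n²⇒m≤n : ∀ {m n} → m ℕ.* m ℕ.≤ n ℕ.* n → m ℕ.≤ n
m²≤n²⇒m≤n m²≤n² = ℕ.≮⇒≥ (λ n<m → ℕ.<⇒≱ (ℕ.*-mono-< n<m n<m) m²≤n²)

-- The square of the smaller factor is at most the product. This combines the squared lower bounds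
-- on |A_i| and |A_j| without square roots.
≤-geometric-mean : ∀ {x y z} → z ℕ.≤ x ℕ.* x → z ℕ.≤ y ℕ.* y → z ℕ.≤ x ℕ.* y
≤-geometric-mean {x} {y} z≤x² z≤y² with ℕ.≤-total x y
... | inj₁ x≤y = ℕ.≤-trans z≤x² (ℕ.*-monoʳ-≤ x x≤y)
... | inj₂ y≤x = ℕ.≤-trans z≤y² (ℕ.*-monoˡ-≤ y y≤x)

∑-tuples : ∀ {T : Set} (V : List T) {k} {A : Fin k → Pred T 0ℓ} (A? : ∀ i → Decidable (A i)) →
           ∑[ x ← vectors V k ] 𝟙 (Fin.all? (λ i → A? i (lookup x i))) ≡
           + product (List.map (λ i → length (filter (A? i) V)) (allFin k))
∑-tuples V {zero}  A? = refl
∑-tuples V {suc k} A? = begin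
  _ ≡⟨ ∑-vectors-suc V k _ ⟩
  _ ≡⟨ ∑-cong V (λ a → ∑-cong (vectors V k) (λ x → 𝟙-× (Fin.all? (λ i → A? i (lookup (a ∷ x) i)))
         (A? Fin.zero a) (Fin.all? (λ i → A? (Fin.suc i) (lookup x i)))
         (λ inA → inA Fin.zero , inA ∘ Fin.suc) (λ { a∈A inA Fin.zero → a∈A ; a∈A inA (Fin.suc i) → inA i }))) ⟩
  _ ≡⟨ ∑*∑ V (vectors V k) _ _ ⟨
  _ ≡⟨ cong₂ _*_ (sym (length-filter-∑ (A? Fin.zero) V)) (∑-tuples V (A? ∘ Fin.suc)) ⟩
  _ ≡⟨ ℤ.pos-* (size Fin.zero) _ ⟨
  _ ≡⟨ cong (λ ns → + (size Fin.zero ℕ.* product ns))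
         (trans (List.map-tabulate (λ i → i) (size ∘ Fin.suc)) (sym (List.map-tabulate Fin.suc size))) ⟩
  _ ∎
  where
  open ≡-Reasoning
  size : Fin (suc k) → ℕ
  size i = length (filter (A? i) V)

-- Induction on the number of pairs

module Counting {q : ℕ} (F : FiniteField q) {d k : ℕ}
                (B : Vec (FiniteField.Carrier F) d → Vec (FiniteField.Carrier F) d → FiniteField.Carrier F)
                (bilinear : IsBilinear F B) (nonDegenerate : IsNonDegenerate F B)
                (lam : Fin k → Fin k → FiniteField.Carrier F)
                (A : Fin k → Pred (Vec (FiniteField.Carrier F) d) 0ℓ) (A? : ∀ i → Decidable (A i)) where
  open FiniteField F using (Carrier; 0#; _≟_; elements; q≢0)
  open FieldSums F using (length-space)
  open Systems F B bilinear nonDegenerate lam A A?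

  P : ℕ
  P = ∏card F A?

  α : Fin k → ℕ
  α i = card F (A? i)

  solutionCount≡count : ∀ E → solutionCount F B E lam A? ≡ count (PairSet.pairs E)
  solutionCount≡count E = ℤ.+-injective (begin
    _ ≡⟨ length-filter-∑ _ X ⟩
    _ ≡⟨ ∑-cong X (λ x → 𝟙-cong (Fin.all? (λ i → A? i (lookup x i)) ×-dec system? F B E lam x)
           (sol? (PairSet.pairs E) x) (λ (inA , holds) → ⟨ inA ∣ holds ⟩) (λ (⟨ inA ∣ holds ⟩) → inA , holds)) ⟩
    _ ≡⟨ count-∑ (PairSet.pairs E) ⟨
    _ ∎)
    where open ≡-Reasoning

  count-[] : count [] ≡ P
  count-[] = ℤ.+-injective (begin
    _ ≡⟨ count-∑ [] ⟩
    _ ≡⟨ ∑-cong X (λ x → 𝟙-cong (sol? [] x) (Fin.all? (λ i → A? i (lookup x i)))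
           Sol.members (λ inA → ⟨ inA ∣ [] ⟩)) ⟩
    _ ≡⟨ ∑-tuples V A? ⟩
    + P ∎)
    where open ≡-Reasoning

  -- The count normalised to have expected value `P`; multiplying by the power of q instead of
  -- dividing keeps the induction in ℕ.
  scaled : List (Edge k) → ℕ
  scaled L = q ℕ.^ length L ℕ.* count L

  -- The hypotheses on the pairs, in a form inherited by tails and by `delete v`.
  record Admissible (t : ℕ) (L : List (Edge k)) : Set where
    field
      distinct : All (λ (i , j) → i ≢ j) L
      noRepeat : AllPairs (λ e f → ¬ SamePair e f) L
      nonzero  : All (λ (i , j) → lam i j ≢ 0#) L
      degree≤t : ∀ v → degree v L ℕ.≤ t

  Admissible-tail : ∀ {t e L} → Admissible t (e ∷ L) → Admissible t L
  Admissible-tail {e = e} {L} adm = record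
    { distinct = All.tail distinct
    ; noRepeat = AllPairs.tail noRepeat
    ; nonzero  = All.tail nonzero
    ; degree≤t = λ v → ℕ.≤-trans (length-filter-∷ (incident? v) e L) (degree≤t v)
    } where open Admissible adm

  Admissible-delete : ∀ {t L} v → Admissible t L → Admissible t (delete v L)
  Admissible-delete {L = L} v adm = record
    { distinct = All.filter⁺ ∉? distinct
    ; noRepeat = AllPairs.filter⁺ ∉? noRepeat
    ; nonzero  = All.filter⁺ ∉? nonzero
    ; degree≤t = λ w → ℕ.≤-trans (length-filter-filter (incident? w) ∉? L) (degree≤t w)
    }
    where
    open Admissible adm
    ∉? = ¬? ∘ incident? v

  edge-discrepancy-ℕ : ∀ {i j L} → i ≢ j → lam i j ≢ 0# → All (λ e → ¬ SamePair (i , j) e) L →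
    let D = ℕ.∣ q ℕ.* count ((i , j) ∷ L) - count L ∣ in
    D ℕ.* D ℕ.* (α i ℕ.* α j) ℕ.≤ q ℕ.* q ℕ.^ d ℕ.* (count (delete i L) ℕ.* count (delete j L))
  edge-discrepancy-ℕ {i} {j} {L} i≢j lam≢0 new = ℤ.drop‿+≤+ (begin
    + (D ℕ.* D ℕ.* (α i ℕ.* α j))                         ≡⟨ ℤ.pos-* (D ℕ.* D) _ ⟩
    + (D ℕ.* D) * + (α i ℕ.* α j)                         ≡⟨ cong₂ _*_ D²≡ (ℤ.pos-* (α i) (α j)) ⟩
    δ * δ * (+ α i * + α j)                               ≤⟨ edge-discrepancy i≢j lam≢0 new ⟩
    + q * N * (+ count (delete i L) * + count (delete j L))
      ≡⟨ cong₂ _*_ (trans (sym (ℤ.pos-* q _)) (cong (λ n → + (q ℕ.* n)) (length-space d))) (sym (ℤ.pos-* (count (delete i L)) _)) ⟩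
    + (q ℕ.* q ℕ.^ d) * + (count (delete i L) ℕ.* count (delete j L)) ≡⟨ ℤ.pos-* (q ℕ.* q ℕ.^ d) _ ⟨
    + (q ℕ.* q ℕ.^ d ℕ.* (count (delete i L) ℕ.* count (delete j L))) ∎)
    where
    open ℤ.≤-Reasoning
    δ : ℤ
    δ = discrepancy i≢j lam≢0 new
    D : ℕ
    D = ℕ.∣ q ℕ.* count ((i , j) ∷ L) - count L ∣
    ∣δ∣≡D : ℤ.∣ δ ∣ ≡ D
    ∣δ∣≡D = trans (cong (λ z → ℤ.∣ z - + count L ∣) (sym (ℤ.pos-* q (count ((i , j) ∷ L))))) (∣+m-+n∣ _ (count L))
    D²≡ : + (D ℕ.* D) ≡ δ * δ
    D²≡ = trans (cong (λ n → + (n ℕ.* n)) (sym ∣δ∣≡D)) (∣i∣²≡i² δ)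

  -- Each pair is allowed a relative error of 1/K, and `large` is the squared lower bound on |A_i|
  -- with C = 2K.
  module Induction (t K : ℕ) .{{K≢0 : ℕ.NonZero K}} (1≤d : 1 ℕ.≤ d)
                   (large : ∀ i → 2 ℕ.* K ℕ.* (2 ℕ.* K) ℕ.* q ℕ.^ ((d ∸ 1) ℕ.+ 2 ℕ.* t) ℕ.≤ α i ℕ.* α i) where

    -- Relative error at most |L|/K, cleared of denominators.
    Close : List (Edge k) → Set
    Close L = K ℕ.* ℕ.∣ scaled L - P ∣ ℕ.≤ length L ℕ.* P

    -- With at most K pairs the relative error is at most 1. Only this crude consequence is needed
    -- for the deleted systems in `edge-step`.
    Close⇒≤ : ∀ {L} → length L ℕ.≤ K → Close L → scaled L ℕ.≤ 2 ℕ.* P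
    Close⇒≤ {L} l≤K close = begin
      scaled L                  ≤⟨ ℕ.m≤n+∣m-n∣ (scaled L) P ⟩
      P ℕ.+ ℕ.∣ scaled L - P ∣    ≤⟨ ℕ.+-monoʳ-≤ P (ℕ.*-cancelˡ-≤ K (ℕ.≤-trans close (ℕ.*-monoˡ-≤ P l≤K))) ⟩
      P ℕ.+ P                   ≡⟨ cong (P ℕ.+_) (sym (ℕ.+-identityʳ P)) ⟩
      2 ℕ.* P ∎
      where open ℕ.≤-Reasoning

    -- This is `edge-discrepancy-ℕ` with the powers of q distributed over the two deleted systems;
    -- what remains of them is absorbed by the size of A_i and A_j.
    edge-step : ∀ {i j L} → Admissible t ((i , j) ∷ L) →
                scaled (delete i L) ℕ.≤ 2 ℕ.* P → scaled (delete j L) ℕ.≤ 2 ℕ.* P →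
                K ℕ.* ℕ.∣ scaled ((i , j) ∷ L) - scaled L ∣ ℕ.≤ P
    -- The inequality is squared and multiplied by 4Q: with K² the 4 forms the (2K)² of `large`, and
    -- with P² it forms the product of the two bounds 2P.
    edge-step {i} {j} {L} adm sᵢ≤2P sⱼ≤2P = m²≤n²⇒m≤n (ℕ.*-cancelˡ-≤ (4 ℕ.* Q) {{4Q≢0}} (begin
      4 ℕ.* Q ℕ.* (K ℕ.* Δ ℕ.* (K ℕ.* Δ))                     ≡⟨ shuffle₁ Q K Δ ⟩
      Δ ℕ.* Δ ℕ.* (2 ℕ.* K ℕ.* (2 ℕ.* K) ℕ.* Q)
        ≤⟨ ℕ.*-monoʳ-≤ (Δ ℕ.* Δ) (≤-geometric-mean {α i} {α j} (large i) (large j)) ⟩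
      Δ ℕ.* Δ ℕ.* (α i ℕ.* α j)                               ≡⟨ cong (λ z → z ℕ.* z ℕ.* (α i ℕ.* α j)) Δ≡ ⟩
      qˡ ℕ.* D ℕ.* (qˡ ℕ.* D) ℕ.* (α i ℕ.* α j)               ≡⟨ shuffle₂ qˡ D (α i ℕ.* α j) ⟩
      qˡ ℕ.* qˡ ℕ.* (D ℕ.* D ℕ.* (α i ℕ.* α j))
        ≤⟨ ℕ.*-monoʳ-≤ (qˡ ℕ.* qˡ) (edge-discrepancy-ℕ (All.head distinct) (All.head nonzero) (AllPairs.head noRepeat)) ⟩
      qˡ ℕ.* qˡ ℕ.* (q ℕ.* q ℕ.^ d ℕ.* (cᵢ ℕ.* cⱼ))
        -- One copy of q^|L| is split at i and the other at j: the pairs avoiding the vertex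
        -- normalise the deleted count, and the pairs through it leave a power of q with its degree
        -- as exponent.
        ≡⟨ cong₂ (λ u v → u ℕ.* v ℕ.* (q ℕ.* q ℕ.^ d ℕ.* (cᵢ ℕ.* cⱼ))) (split i) (split j) ⟩
      qⁱ ℕ.* pⁱ ℕ.* (qʲ ℕ.* pʲ) ℕ.* (q ℕ.* q ℕ.^ d ℕ.* (cᵢ ℕ.* cⱼ)) ≡⟨ shuffle₃ qⁱ pⁱ qʲ pʲ (q ℕ.* q ℕ.^ d) cᵢ cⱼ ⟩
      pⁱ ℕ.* pʲ ℕ.* (q ℕ.* q ℕ.^ d) ℕ.* (scaled (delete i L) ℕ.* scaled (delete j L))
        ≤⟨ ℕ.*-mono-≤ exponent (ℕ.*-mono-≤ sᵢ≤2P sⱼ≤2P) ⟩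
      Q ℕ.* (2 ℕ.* P ℕ.* (2 ℕ.* P))                           ≡⟨ shuffle₄ Q P ⟩
      4 ℕ.* Q ℕ.* (P ℕ.* P) ∎))
      where
      open ℕ.≤-Reasoning
      open Admissible adm
      Δ D qˡ cᵢ cⱼ qⁱ qʲ pⁱ pʲ Q : ℕ
      Δ  = ℕ.∣ scaled ((i , j) ∷ L) - scaled L ∣
      D  = ℕ.∣ q ℕ.* count ((i , j) ∷ L) - count L ∣
      qˡ = q ℕ.^ length L
      cᵢ = count (delete i L)
      cⱼ = count (delete j L)
      qⁱ = q ℕ.^ length (delete i L)
      qʲ = q ℕ.^ length (delete j L)
      pⁱ = q ℕ.^ degree i L
      pʲ = q ℕ.^ degree j L
      Q  = q ℕ.^ ((d ∸ 1) ℕ.+ 2 ℕ.* t)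
      4Q≢0 : ℕ.NonZero (4 ℕ.* Q)
      4Q≢0 = ℕ.m*n≢0 4 Q {{_}} {{ℕ.m^n≢0 q ((d ∸ 1) ℕ.+ 2 ℕ.* t) {{q≢0}}}}
      Δ≡ : Δ ≡ qˡ ℕ.* D
      Δ≡ = trans (cong (λ z → ℕ.∣ z - scaled L ∣) (trans (cong (ℕ._* count ((i , j) ∷ L)) (ℕ.*-comm q qˡ)) (ℕ.*-assoc qˡ q _)))
                 (sym (ℕ.*-distribˡ-∣-∣ qˡ _ _))
      split : ∀ v → qˡ ≡ q ℕ.^ length (delete v L) ℕ.* q ℕ.^ degree v L
      split v = trans (cong (q ℕ.^_) (sym (length-filter-¬ (incident? v) L))) (ℕ.^-distribˡ-+-* q (length (delete v L)) (degree v L))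
      -- The pair (i , j) itself uses up one unit of the degree at i and at j. These two units make
      -- up the difference between the exponents d + 1 and d - 1.
      degree<t : ∀ v → Incident v (i , j) → suc (degree v L) ℕ.≤ t
      degree<t v v∈e = subst (ℕ._≤ t) (cong length (List.filter-accept (incident? v) {(i , j)} {L} v∈e)) (degree≤t v)
      exponent≤ : degree i L ℕ.+ degree j L ℕ.+ suc d ℕ.≤ (d ∸ 1) ℕ.+ 2 ℕ.* t
      exponent≤ = begin
        degree i L ℕ.+ degree j L ℕ.+ suc d
          ≡⟨ cong (λ n → degree i L ℕ.+ degree j L ℕ.+ suc n) (ℕ.m+[n∸m]≡n 1≤d) ⟨
        degree i L ℕ.+ degree j L ℕ.+ suc (suc (d ∸ 1))              ≡⟨ shuffle₅ (degree i L) (degree j L) (d ∸ 1) ⟩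
        (d ∸ 1) ℕ.+ (suc (degree i L) ℕ.+ suc (degree j L))
          ≤⟨ ℕ.+-monoʳ-≤ (d ∸ 1) (ℕ.+-mono-≤ (degree<t i (inj₁ refl)) (degree<t j (inj₂ refl))) ⟩
        (d ∸ 1) ℕ.+ (t ℕ.+ t)
          ≡⟨ cong (λ n → (d ∸ 1) ℕ.+ (t ℕ.+ n)) (ℕ.+-identityʳ t) ⟨
        (d ∸ 1) ℕ.+ 2 ℕ.* t ∎
        where
        shuffle₅ : ∀ a b c → a ℕ.+ b ℕ.+ suc (suc c) ≡ c ℕ.+ (suc a ℕ.+ suc b)
        shuffle₅ = ℕ-Solver.solve-∀
      exponent : pⁱ ℕ.* pʲ ℕ.* (q ℕ.* q ℕ.^ d) ℕ.≤ Q
      exponent = begin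
        pⁱ ℕ.* pʲ ℕ.* (q ℕ.^ suc d)
          ≡⟨ cong (ℕ._* q ℕ.^ suc d) (ℕ.^-distribˡ-+-* q (degree i L) (degree j L)) ⟨
        q ℕ.^ (degree i L ℕ.+ degree j L) ℕ.* q ℕ.^ suc d ≡⟨ ℕ.^-distribˡ-+-* q (degree i L ℕ.+ degree j L) (suc d) ⟨
        q ℕ.^ (degree i L ℕ.+ degree j L ℕ.+ suc d)      ≤⟨ ℕ.^-monoʳ-≤ q {{q≢0}} exponent≤ ⟩
        Q ∎
      shuffle₁ : ∀ Q K Δ → 4 ℕ.* Q ℕ.* (K ℕ.* Δ ℕ.* (K ℕ.* Δ)) ≡ Δ ℕ.* Δ ℕ.* (2 ℕ.* K ℕ.* (2 ℕ.* K) ℕ.* Q)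
      shuffle₁ = ℕ-Solver.solve-∀
      shuffle₂ : ∀ x D c → x ℕ.* D ℕ.* (x ℕ.* D) ℕ.* c ≡ x ℕ.* x ℕ.* (D ℕ.* D ℕ.* c)
      shuffle₂ = ℕ-Solver.solve-∀
      shuffle₃ : ∀ a b c d e x y → a ℕ.* b ℕ.* (c ℕ.* d) ℕ.* (e ℕ.* (x ℕ.* y)) ≡ b ℕ.* d ℕ.* e ℕ.* (a ℕ.* x ℕ.* (c ℕ.* y))
      shuffle₃ = ℕ-Solver.solve-∀
      shuffle₄ : ∀ Q P → Q ℕ.* (2 ℕ.* P ℕ.* (2 ℕ.* P)) ≡ 4 ℕ.* Q ℕ.* (P ℕ.* P)
      shuffle₄ = ℕ-Solver.solve-∀

    -- The hypothesis is needed for `delete i L` and `delete j L` as well as for the tail. These are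
    -- not subterms of the list, so the induction runs on a bound n for the length.
    close : ∀ n L → length L ℕ.≤ n → length L ℕ.≤ K → Admissible t L → Close L
    close n [] _ _ _ = ℕ.≤-reflexive (begin
      K ℕ.* ℕ.∣ 1 ℕ.* count [] - P ∣ ≡⟨ cong (λ z → K ℕ.* ℕ.∣ z - P ∣) (trans (ℕ.*-identityˡ (count [])) count-[]) ⟩
      K ℕ.* ℕ.∣ P - P ∣              ≡⟨ cong (K ℕ.*_) (ℕ.∣n-n∣≡0 P) ⟩
      K ℕ.* 0                      ≡⟨ ℕ.*-zeroʳ K ⟩
      0 ∎)
      where open ≡-Reasoning
    close (suc n) (e@(i , j) ∷ L) (s≤s l≤n) l<K adm = begin
      K ℕ.* ℕ.∣ scaled (e ∷ L) - P ∣
        ≤⟨ ℕ.*-monoʳ-≤ K (ℕ.∣-∣-triangle (scaled (e ∷ L)) (scaled L) P) ⟩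
      K ℕ.* (ℕ.∣ scaled (e ∷ L) - scaled L ∣ ℕ.+ ℕ.∣ scaled L - P ∣)
        ≡⟨ ℕ.*-distribˡ-+ K _ _ ⟩
      K ℕ.* ℕ.∣ scaled (e ∷ L) - scaled L ∣ ℕ.+ K ℕ.* ℕ.∣ scaled L - P ∣
        ≤⟨ ℕ.+-mono-≤ (edge-step adm (bounded i) (bounded j)) (close n L l≤n l≤K adm′) ⟩
      P ℕ.+ length L ℕ.* P ∎
      where
      open ℕ.≤-Reasoning
      adm′ : Admissible t L
      adm′ = Admissible-tail adm
      l≤K : length L ℕ.≤ K
      l≤K = ℕ.≤-trans (ℕ.n≤1+n _) l<K
      bounded : ∀ v → scaled (delete v L) ℕ.≤ 2 ℕ.* P
      bounded v = Close⇒≤ {delete v L} (shorter l≤K) (close n (delete v L) (shorter l≤n) (shorter l≤K) (Admissible-delete v adm′))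
        where
        shorter : ∀ {m} → length L ℕ.≤ m → length (delete v L) ℕ.≤ m
        shorter = ℕ.≤-trans (List.length-filter (¬? ∘ incident? v) L)

-- Passage to rational numbers

toℚᵘ-/1 : ∀ i → toℚᵘ (i / 1) ℚᵘ.≃ mkℚᵘ i 0
toℚᵘ-/1 i = ℚ.toℚᵘ-fromℚᵘ (mkℚᵘ i 0)

/1-* : ∀ i j → (i * j) / 1 ≡ (i / 1) ℚ.* (j / 1)
/1-* i j = ℚ.toℚᵘ-injective (begin
  toℚᵘ ((i * j) / 1)              ≈⟨ toℚᵘ-/1 (i * j) ⟩
  mkℚᵘ i 0 ℚᵘ.* mkℚᵘ j 0          ≈⟨ ℚᵘ.*-cong (toℚᵘ-/1 i) (toℚᵘ-/1 j) ⟨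
  toℚᵘ (i / 1) ℚᵘ.* toℚᵘ (j / 1)  ≈⟨ ℚ.toℚᵘ-homo-* (i / 1) (j / 1) ⟨
  toℚᵘ ((i / 1) ℚ.* (j / 1)) ∎)
  where open ℚᵘ.≃-Reasoning

/1-- : ∀ i j → (i - j) / 1 ≡ (i / 1) ℚ.- (j / 1)
/1-- i j = ℚ.toℚᵘ-injective (begin
  toℚᵘ ((i - j) / 1)                    ≈⟨ toℚᵘ-/1 (i - j) ⟩
  mkℚᵘ (i - j) 0                        ≈⟨ ℚᵘ.*≡* (cong (_* 1ℤ) (sym (cong₂ _+_ (ℤ.*-identityʳ i) (ℤ.*-identityʳ (- j))))) ⟩
  mkℚᵘ i 0 ℚᵘ.- mkℚᵘ j 0                ≈⟨ ℚᵘ.+-cong (toℚᵘ-/1 i) (ℚᵘ.-‿cong (toℚᵘ-/1 j)) ⟨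
  toℚᵘ (i / 1) ℚᵘ.- toℚᵘ (j / 1)        ≈⟨ ℚᵘ.+-congʳ (toℚᵘ (i / 1)) (ℚ.toℚᵘ-homo‿- (j / 1)) ⟨
  toℚᵘ (i / 1) ℚᵘ.+ toℚᵘ (ℚ.- (j / 1))  ≈⟨ ℚ.toℚᵘ-homo-+ (i / 1) (ℚ.- (j / 1)) ⟨
  toℚᵘ ((i / 1) ℚ.- (j / 1)) ∎)
  where open ℚᵘ.≃-Reasoning

/1-∣∣ : ∀ i → ∣ i / 1 ∣ ≡ fromℕ ℤ.∣ i ∣
/1-∣∣ i = ℚ.toℚᵘ-injective (begin
  toℚᵘ ∣ i / 1 ∣        ≈⟨ ℚ.toℚᵘ-homo-∣-∣ (i / 1) ⟩
  ℚᵘ.∣ toℚᵘ (i / 1) ∣   ≈⟨ ℚᵘ.∣-∣-cong (toℚᵘ-/1 i) ⟩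
  ℚᵘ.∣ mkℚᵘ i 0 ∣       ≈⟨ toℚᵘ-/1 (+ ℤ.∣ i ∣) ⟨
  toℚᵘ (fromℕ ℤ.∣ i ∣) ∎)
  where open ℚᵘ.≃-Reasoning

fromℕ-* : ∀ m n → fromℕ (m ℕ.* n) ≡ fromℕ m ℚ.* fromℕ n
fromℕ-* m n = trans (cong (_/ 1) (ℤ.pos-* m n)) (/1-* (+ m) (+ n))

∣fromℕ-fromℕ∣ : ∀ m n → ∣ fromℕ m ℚ.- fromℕ n ∣ ≡ fromℕ ℕ.∣ m - n ∣
∣fromℕ-fromℕ∣ m n = trans (cong ∣_∣ (sym (/1-- (+ m) (+ n)))) (trans (/1-∣∣ (+ m - + n)) (cong fromℕ (∣+m-+n∣ m n)))

fromℕ-mono-≤ : ∀ {m n} → m ℕ.≤ n → fromℕ m ℚ.≤ fromℕ n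
fromℕ-mono-≤ {m} {n} m≤n = ℚ.toℚᵘ-cancel-≤ (begin
  toℚᵘ (fromℕ m) ≃⟨ toℚᵘ-/1 (+ m) ⟩
  mkℚᵘ (+ m) 0   ≤⟨ ℚᵘ.*≤* (ℤ.*-monoʳ-≤-nonNeg 1ℤ (ℤ.+≤+ m≤n)) ⟩
  mkℚᵘ (+ n) 0   ≃⟨ toℚᵘ-/1 (+ n) ⟨
  toℚᵘ (fromℕ n) ∎)
  where open ℚᵘ.≤-Reasoning

fromℕ-cancel-≤ : ∀ {m n} → fromℕ m ℚ.≤ fromℕ n → m ℕ.≤ n
fromℕ-cancel-≤ {m} {n} m≤n = ℤ.drop‿+≤+ (ℤ.*-cancelʳ-≤-pos (+ m) (+ n) 1ℤ (ℚᵘ.drop-*≤* (begin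
  mkℚᵘ (+ m) 0   ≃⟨ toℚᵘ-/1 (+ m) ⟨
  toℚᵘ (fromℕ m) ≤⟨ ℚ.toℚᵘ-mono-≤ m≤n ⟩
  toℚᵘ (fromℕ n) ≃⟨ toℚᵘ-/1 (+ n) ⟩
  mkℚᵘ (+ n) 0   ∎)))
  where open ℚᵘ.≤-Reasoning

0<fromℕ : ∀ n .{{_ : ℕ.NonZero n}} → 0ℚ ℚ.< fromℕ n
0<fromℕ n = ℚ.≰⇒> (λ n≤0 → ℕ.<⇒≱ (ℕ.>-nonZero⁻¹ n) (fromℕ-cancel-≤ {n} {0} n≤0))

1/n*n : ∀ n .{{_ : ℕ.NonZero n}} → (+ 1 / n) ℚ.* fromℕ n ≡ 1ℚ
1/n*n n@(suc n-1) = ℚ.toℚᵘ-injective (begin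
  toℚᵘ ((+ 1 / n) ℚ.* fromℕ n)            ≈⟨ ℚ.toℚᵘ-homo-* (+ 1 / n) (fromℕ n) ⟩
  toℚᵘ (+ 1 / n) ℚᵘ.* toℚᵘ (fromℕ n)      ≈⟨ ℚᵘ.*-cong (ℚ.toℚᵘ-fromℚᵘ (mkℚᵘ (+ 1) n-1)) (toℚᵘ-/1 (+ n)) ⟩
  mkℚᵘ (+ 1) n-1 ℚᵘ.* mkℚᵘ (+ n) 0        ≈⟨ ℚᵘ.*≡* (trans (ℤ.*-identityʳ (1ℤ * + n)) (cong (1ℤ *_) (sym (ℤ.*-identityʳ (+ n))))) ⟩
  toℚᵘ 1ℚ ∎)
  where open ℚᵘ.≃-Reasoning

-- A positive numerator is at least 1, so the denominator m of ε satisfies 1/m ≤ ε.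
1≤denominator*ε : ∀ ε → 0ℚ ℚ.< ε → 1ℚ ℚ.≤ fromℕ (ℚ.↧ₙ ε) ℚ.* ε
1≤denominator*ε ε@(mkℚ (+ suc n) m _) _ = ℚ.toℚᵘ-cancel-≤ (begin
  toℚᵘ 1ℚ                             ≤⟨ ℚᵘ.*≤* (ℤ.+≤+ (cross m n)) ⟩
  mkℚᵘ (+ suc m) 0 ℚᵘ.* toℚᵘ ε        ≃⟨ ℚᵘ.*-congʳ {toℚᵘ ε} (toℚᵘ-/1 (+ suc m)) ⟨
  toℚᵘ (fromℕ (suc m)) ℚᵘ.* toℚᵘ ε    ≃⟨ ℚ.toℚᵘ-homo-* (fromℕ (suc m)) ε ⟨
  toℚᵘ (fromℕ (suc m) ℚ.* ε) ∎)
  where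
  open ℚᵘ.≤-Reasoning
  cross : ∀ m n → suc (m ℕ.+ 0 ℕ.+ 0) ℕ.≤ suc ((n ℕ.+ m ℕ.* suc n) ℕ.* 1)
  cross m n = s≤s (subst₂ ℕ._≤_ (sym (trans (ℕ.+-identityʳ (m ℕ.+ 0)) (ℕ.+-identityʳ m)))
    (sym (ℕ.*-identityʳ (n ℕ.+ m ℕ.* suc n))) (ℕ.s≤s⁻¹ (ℕ.m≤m*n (suc m) (suc n))))
1≤denominator*ε (mkℚ (+ zero) _ _)   0<ε = contradiction (ℚ.drop-*<* 0<ε) (λ { (ℤ.+<+ ()) })
1≤denominator*ε (mkℚ (ℤ.-[1+ _ ]) _ _) 0<ε = contradiction (ℚ.drop-*<* 0<ε) (λ ())

-- Since S - P/n = (n S - P)/n, it suffices that |n S - P| is at most P/m for the denominator m of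
-- ε.
scaled-estimate : ∀ ε → 0ℚ ℚ.< ε → ∀ n .{{_ : ℕ.NonZero n}} S P →
  ℚ.↧ₙ ε ℕ.* ℕ.∣ n ℕ.* S - P ∣ ℕ.≤ P →
  ∣ fromℕ S ℚ.- (+ 1 / n) ℚ.* fromℕ P ∣ ℚ.≤ ε ℚ.* ((+ 1 / n) ℚ.* fromℕ P)
scaled-estimate ε 0<ε n S P close = begin
  ∣ fromℕ S ℚ.- r ℚ.* fromℕ P ∣                           ≡⟨ cong ∣_∣ factor ⟩
  ∣ r ℚ.* (fromℕ (n ℕ.* S) ℚ.- fromℕ P) ∣                 ≡⟨ ℚ.∣p*q∣≡∣p∣*∣q∣ r _ ⟩
  ∣ r ∣ ℚ.* ∣ fromℕ (n ℕ.* S) ℚ.- fromℕ P ∣               ≡⟨ cong₂ ℚ._*_ (ℚ.0≤p⇒∣p∣≡p 0≤r) (∣fromℕ-fromℕ∣ (n ℕ.* S) P) ⟩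
  r ℚ.* fromℕ Δ                                           ≤⟨ ℚ.*-monoˡ-≤-nonNeg r {{ℚ.nonNegative 0≤r}} Δ≤εP ⟩
  r ℚ.* (ε ℚ.* fromℕ P)                                   ≡⟨ ℚ.*-assoc r ε (fromℕ P) ⟨
  r ℚ.* ε ℚ.* fromℕ P                                     ≡⟨ cong (ℚ._* fromℕ P) (ℚ.*-comm r ε) ⟩
  ε ℚ.* r ℚ.* fromℕ P                                     ≡⟨ ℚ.*-assoc ε r (fromℕ P) ⟩
  ε ℚ.* (r ℚ.* fromℕ P) ∎
  where
  open ℚ.≤-Reasoning
  r : ℚ
  r = + 1 / n
  m Δ : ℕ
  m = ℚ.↧ₙ ε
  Δ = ℕ.∣ n ℕ.* S - P ∣
  0≤r : 0ℚ ℚ.≤ r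
  0≤r = ℚ.<⇒≤ (ℚ.positive⁻¹ r {{ℚ.normalize-pos 1 n}})
  factor : fromℕ S ℚ.- r ℚ.* fromℕ P ≡ r ℚ.* (fromℕ (n ℕ.* S) ℚ.- fromℕ P)
  factor = begin-equality
    fromℕ S ℚ.- r ℚ.* fromℕ P                       ≡⟨ cong (ℚ._- r ℚ.* fromℕ P) (ℚ.*-identityˡ (fromℕ S)) ⟨
    1ℚ ℚ.* fromℕ S ℚ.- r ℚ.* fromℕ P                ≡⟨ cong (λ z → z ℚ.* fromℕ S ℚ.- r ℚ.* fromℕ P) (1/n*n n) ⟨
    r ℚ.* fromℕ n ℚ.* fromℕ S ℚ.- r ℚ.* fromℕ P
      ≡⟨ cong₂ ℚ._+_ (trans (ℚ.*-assoc r (fromℕ n) (fromℕ S)) (cong (r ℚ.*_) (sym (fromℕ-* n S))))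
          (ℚ.neg-distribʳ-* r (fromℕ P)) ⟩
    r ℚ.* fromℕ (n ℕ.* S) ℚ.+ r ℚ.* (ℚ.- fromℕ P)   ≡⟨ ℚ.*-distribˡ-+ r (fromℕ (n ℕ.* S)) (ℚ.- fromℕ P) ⟨
    r ℚ.* (fromℕ (n ℕ.* S) ℚ.- fromℕ P) ∎
  Δ≤εP : fromℕ Δ ℚ.≤ ε ℚ.* fromℕ P
  Δ≤εP = ℚ.*-cancelˡ-≤-pos (fromℕ m) {{ℚ.positive (0<fromℕ m)}} (begin
    fromℕ m ℚ.* fromℕ Δ          ≡⟨ fromℕ-* m Δ ⟨
    fromℕ (m ℕ.* Δ)              ≤⟨ fromℕ-mono-≤ close ⟩
    fromℕ P                      ≡⟨ ℚ.*-identityˡ (fromℕ P) ⟨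
    1ℚ ℚ.* fromℕ P
      ≤⟨ ℚ.*-monoʳ-≤-nonNeg (fromℕ P) {{ℚ.nonNegative (fromℕ-mono-≤ {0} {P} z≤n)}} (1≤denominator*ε ε 0<ε) ⟩
    fromℕ m ℚ.* ε ℚ.* fromℕ P    ≡⟨ ℚ.*-assoc (fromℕ m) ε (fromℕ P) ⟩
    fromℕ m ℚ.* (ε ℚ.* fromℕ P) ∎)

AtLeast⇒≤ : ∀ {x c q m} → AtLeast x (fromℕ c) q m → c ℕ.* c ℕ.* q ℕ.^ m ℕ.≤ x ℕ.* x
AtLeast⇒≤ {x} {c} {q} {m} large = fromℕ-cancel-≤ (begin
  fromℕ (c ℕ.* c ℕ.* q ℕ.^ m)                  ≡⟨ fromℕ-* (c ℕ.* c) (q ℕ.^ m) ⟩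
  fromℕ (c ℕ.* c) ℚ.* fromℕ (q ℕ.^ m)          ≡⟨ cong (ℚ._* fromℕ (q ℕ.^ m)) (fromℕ-* c c) ⟩
  fromℕ c ℚ.* fromℕ c ℚ.* fromℕ (q ℕ.^ m)      ≤⟨ large ⟩
  fromℕ x ℚ.* fromℕ x                          ≡⟨ fromℕ-* x x ⟨
  fromℕ (x ℕ.* x) ∎)
  where open ℚ.≤-Reasoning

-- The choice of the constant C

theorem1p1 :
    (d k : ℕ) → 1 ℕ.≤ d → 2 ℕ.≤ k →
    (ε : ℚ) → 0ℚ ℚ.< ε →
    ∃[ C ] (0ℚ ℚ.< C ×
      ((t : ℕ) → 1 ℕ.≤ t → t ℕ.≤ k ∸ 1 →
       (E : PairSet k) → (∀ i → PairSet.degree E i ℕ.≤ t) →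
       (q : ℕ) → IsPrimePower q →
       (F : FiniteField q) →
       let open FiniteField F
           l = PairSet.size E
       in
       (B : Vec Carrier d → Vec Carrier d → Carrier) →
       IsBilinear F B → IsNonDegenerate F B →
       (A : Fin k → Pred (Vec Carrier d) 0ℓ) (A? : ∀ i → Decidable (A i)) →
       (∀ i → AtLeast (card F (A? i)) C q ((d ∸ 1) ℕ.+ 2 ℕ.* t)) →
       (lam : Fin k → Fin k → Carrier) →
       All (λ (i , j) → lam i j ≢ 0#) (PairSet.pairs E) →
       let S = fromℕ (solutionCount F B E lam A?)
           M = q^- l ℚ.* fromℕ (∏card F A?)
       in ∣ S ℚ.- M ∣ ℚ.≤ ε ℚ.* M))
-- C = 2K with K = k² m, where m is the denominator of ε: at most k² pairs with a relative error of
-- 1/K each give a total of at most 1/m ≤ ε.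
theorem1p1 d k 1≤d 2≤k ε 0<ε = fromℕ (2 ℕ.* K) , 0<fromℕ (2 ℕ.* K) {{ℕ.m*n≢0 2 K}} ,
  λ t _ _ E degree≤t q _ F B bilinear nonDegenerate A A? large lam lam≢0 →
    let open Counting F B bilinear nonDegenerate lam A A?
        open PairSet E using (pairs; size; distinct; noRepeat)
        instance
          qˡ≢0 : ℕ.NonZero (q ℕ.^ size)
          qˡ≢0 = ℕ.m^n≢0 q size {{FiniteField.q≢0 F}}
        close : K ℕ.* ℕ.∣ q ℕ.^ size ℕ.* solutionCount F B E lam A? - P ∣ ℕ.≤ size ℕ.* P
        close = subst (λ S → K ℕ.* ℕ.∣ q ℕ.^ size ℕ.* S - P ∣ ℕ.≤ size ℕ.* P) (sym (solutionCount≡count E))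
          (Induction.close t K 1≤d (λ i → AtLeast⇒≤ {card F (A? i)} {2 ℕ.* K} {q} {(d ∸ 1) ℕ.+ 2 ℕ.* t} (large i))
            size pairs ℕ.≤-refl (ℕ.≤-trans (size≤k*k E) (ℕ.m≤m*n (k ℕ.* k) (ℚ.↧ₙ ε)))
            (record { distinct = distinct ; noRepeat = noRepeat ; nonzero = lam≢0 ; degree≤t = degree≤t }))
    in scaled-estimate ε 0<ε (q ℕ.^ size) (solutionCount F B E lam A?) P
         -- Cancelling k² from k² m |q^l S - P| ≤ l P ≤ k² P leaves the bound that `scaled-estimate`
         -- asks for.
         (ℕ.*-cancelˡ-≤ (k ℕ.* k) (ℕ.≤-trans (ℕ.≤-reflexive (sym (ℕ.*-assoc (k ℕ.* k) (ℚ.↧ₙ ε) _)))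
           (ℕ.≤-trans close (ℕ.*-monoˡ-≤ P (size≤k*k E)))))
  where
  K : ℕ
  K = k ℕ.* k ℕ.* ℚ.↧ₙ ε
  instance
    k≢0 : ℕ.NonZero k
    k≢0 = ℕ.>-nonZero (ℕ.≤-trans (s≤s z≤n) 2≤k)
    k*k≢0 : ℕ.NonZero (k ℕ.* k)
    k*k≢0 = ℕ.m*n≢0 k k
    K≢0 : ℕ.NonZero K
    K≢0 = ℕ.m*n≢0 (k ℕ.* k) (ℚ.↧ₙ ε)
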